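{- $\mathbf{PTW}\subseteq\mathbf{S_2^P}$.
   Context: Decision problems are identified with languages over $\Sigma=\{0,1\}$ under a standard encoding; $A\leq_P B$ means that $A$ is many-one reducible to $B$ in polynomial time. $\Vert$ denotes concatenation of bit strings. The problem Weak-Tournament-Source: the input is a Boolean circuit $C\colon\{0,1\}^{2n}\to\{0,1\}$; the question is whether there exists $x\in\{0,1\}^n$ such that for all $y\in\{0,1\}^n$ with $y\neq x$ we have $C(x\Vert y)=1$ and $C(y\Vert x)=0$. The class Polynomial Tournament Winner is $\mathbf{PTW}=\{L\subseteq\Sigma^*: L\leq_P \text{Weak-Tournament-Source}\}$. The class $\mathbf{S_2^P}$: a language $L\subseteq\Sigma^*$ is in $\mathbf{S_2^P}$ if there is a polynomial-time predicate $P(\cdot,\cdot,\cdot)$ such that for all $w\in\Sigma^*$: (i) $w\in L\implies \exists x\,\forall y\; P(w,x,y)=1$, and (ii) $w\notin L\implies\exists y\,\forall x\; P(w,x,y)=0$, where $|x|$ and $|y|$ are bounded by a polynomial function of $|w|$. -}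

module Defs where

open import Level using (0ℓ; suc)
open import Data.Bool using (Bool; true; false; _∧_; _∨_; not)
open import Data.Fin using (Fin; toℕ)
open import Data.List using (List; []; _∷_; length; replicate; _∷ʳ_; map) renaming (_++_ to _++ₗ_)
open import Data.Maybe using (Maybe; just; nothing)
open import Data.Nat using (ℕ; _+_; _*_; _≤_) renaming (suc to 1+)
open import Data.Product using (_×_; _,_; ∃-syntax)
open import Data.Vec using (Vec; []; _∷_; _++_; lookup; zipWith; sum) renaming (map to mapᵥ; replicate to replicateᵥ)
open import Function.Bundles using (_↔_; _⇔_)
open import Relation.Nullary using (¬_)
open import Relation.Unary using (Pred; _∈_)
open import Relation.Binary.PropositionalEquality using (_≡_; _≢_)

Word : Set
Word = List Bool

Language : Set₁
Language = Pred Word 0ℓ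

infixl 6 _⊕_
infixl 7 _⊗_

data Poly : Set where
  con     : ℕ → Poly
  X       : Poly
  _⊕_ _⊗_ : Poly → Poly → Poly

⟦_⟧ : Poly → ℕ → ℕ
⟦ con c ⟧ n = c
⟦ X     ⟧ n = n
⟦ p ⊕ q ⟧ n = ⟦ p ⟧ n + ⟦ q ⟧ n
⟦ p ⊗ q ⟧ n = ⟦ p ⟧ n * ⟦ q ⟧ n

-- A finite tape alphabet containing the blank, 0 and 1, together with
-- g further symbols.
data Symbol (g : ℕ) : Set where
  □   : Symbol g
  bit : Bool → Symbol g
  aux : Fin g → Symbol g

data Move : Set where
  goLeft goRight stay : Move

-- A two-way infinite tape. `left` lists the cells to the left of the head,
-- nearest first; cells beyond the end of either list are blank.
record Tape (g : ℕ) : Set where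
  constructor tape
  field
    left  : List (Symbol g)
    head  : Symbol g
    right : List (Symbol g)

open Tape public

module _ {g : ℕ} where

  move : Move → Tape g → Tape g
  move goLeft  (tape []       h rs)       = tape [] □ (h ∷ rs)
  move goLeft  (tape (l ∷ ls) h rs)       = tape ls l (h ∷ rs)
  move goRight (tape ls       h [])       = tape (h ∷ ls) □ []
  move goRight (tape ls       h (r ∷ rs)) = tape (h ∷ ls) r rs
  move stay     t                        = t

  act : Symbol g × Move → Tape g → Tape g
  act (s , m) (tape ls _ rs) = move m (tape ls s rs)

  blankTape : Tape g
  blankTape = tape [] □ []

  inputTape : Word → Tape g
  inputTape []      = blankTape
  inputTape (b ∷ w) = tape [] (bit b) (map bit w)

  leadingBits : List (Symbol g) → Word
  leadingBits (bit b ∷ ss) = b ∷ leadingBits ss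
  leadingBits _            = []

  readTape : Tape g → Word
  readTape t = leadingBits (head t ∷ right t)

-- A machine with a inputs has one output tape (the first), a input tapes,
-- and any fixed number of work tapes. It halts when δ returns nothing.
record TM (a : ℕ) : Set₁ where
  field
    State    : Set
    #states  : ℕ
    finite   : State ↔ Fin #states
    #aux     : ℕ
    #work    : ℕ

  #tapes : ℕ
  #tapes = 1+ (a + #work)

  field
    start : State
    δ     : State → Vec (Symbol #aux) #tapes →
            Maybe (State × Vec (Symbol #aux × Move) #tapes)

  Tapes : Set
  Tapes = Vec (Tape #aux) #tapes

  Config : Set
  Config = State × Tapes

  step : Config → Maybe Config
  step (q , ts) with δ q (mapᵥ head ts)
  ... | nothing          = nothing
  ... | just (q′ , acts) = just (q′ , zipWith act acts ts)

  initial : Vec Word a → Config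
  initial ws = start , blankTape ∷ (mapᵥ inputTape ws ++ replicateᵥ #work blankTape)

  -- HaltsWithin t c ts: from c the machine halts after at most t steps,
  -- leaving the tapes ts.
  data HaltsWithin : ℕ → Config → Tapes → Set where
    halt : ∀ {t q ts} → step (q , ts) ≡ nothing → HaltsWithin t (q , ts) ts
    next : ∀ {t c c′ ts} → step c ≡ just c′ →
           HaltsWithin t c′ ts → HaltsWithin (1+ t) c ts

  -- The output is read from the head of the output tape rightwards, up to
  -- the first symbol that is not a bit.
  output : Tapes → Word
  output (t ∷ _) = readTape t

totalLength : ∀ {a} → Vec Word a → ℕ
totalLength ws = sum (mapᵥ length ws)

PolyTime : ∀ {a} → (Vec Word a → Word) → Set₁
PolyTime {a} f =
  ∃[ M ] ∃[ p ] (∀ (ws : Vec Word a) → let open TM M in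
    ∃[ ts ] HaltsWithin (⟦ p ⟧ (totalLength ws)) (initial ws) ts × output ts ≡ f ws)

PolyTimeFunction : (Word → Word) → Set₁
PolyTimeFunction f = PolyTime {1} λ { (w ∷ []) → f w }

PolyTimePredicate₃ : (Word → Word → Word → Bool) → Set₁
PolyTimePredicate₃ P = PolyTime {3} λ { (w ∷ x ∷ y ∷ []) → P w x y ∷ [] }

infix 4 _≤ₚ_

_≤ₚ_ : Language → Language → Set₁
A ≤ₚ B = ∃[ f ] PolyTimeFunction f × (∀ w → w ∈ A ⇔ f w ∈ B)

-- Circuits are topologically sorted gate lists. In `Circuit k` there are k
-- wires available; each gate adds one wire, which becomes wire 0 and shifts
-- the index of all the earlier ones by one. Hence `Circuit k` is a circuit
-- with k inputs.
data Gate (k : ℕ) : Set where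
  andG orG : Fin k → Fin k → Gate k
  notG     : Fin k → Gate k
  constG   : Bool → Gate k

infixr 5 _▷_

data Circuit (k : ℕ) : Set where
  out : Fin k → Circuit k
  _▷_ : Gate k → Circuit (1+ k) → Circuit k

evalGate : ∀ {k} → Gate k → Vec Bool k → Bool
evalGate (andG i j) v = lookup v i ∧ lookup v j
evalGate (orG i j)  v = lookup v i ∨ lookup v j
evalGate (notG i)   v = not (lookup v i)
evalGate (constG b) v = b

eval : ∀ {k} → Circuit k → Vec Bool k → Bool
eval (out i) v = lookup v i
eval (g ▷ C) v = eval C (evalGate g v ∷ v)

-- Circuits are encoded by a prefix code. Writing wire indices in unary
-- changes the length of an encoding only polynomially, since an index is
-- smaller than the number of inputs and gates.
unary : ℕ → Word
unary n = replicate n true ∷ʳ false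

encodeGate : ∀ {k} → Gate k → Word
encodeGate (andG i j) = false ∷ false ∷ unary (toℕ i) ++ₗ unary (toℕ j)
encodeGate (orG i j)  = false ∷ true  ∷ unary (toℕ i) ++ₗ unary (toℕ j)
encodeGate (notG i)   = true  ∷ false ∷ unary (toℕ i)
encodeGate (constG b) = true  ∷ true  ∷ b ∷ []

encodeGates : ∀ {k} → Circuit k → Word
encodeGates (out i) = false ∷ unary (toℕ i)
encodeGates (g ▷ C) = true ∷ encodeGate g ++ₗ encodeGates C

encode : ∀ n → Circuit (n + n) → Word
encode n C = unary n ++ₗ encodeGates C

HasSource : ∀ n → Circuit (n + n) → Set
HasSource n C =
  ∃[ x ] ∀ (y : Vec Bool n) → y ≢ x → eval C (x ++ y) ≡ true × eval C (y ++ x) ≡ false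

-- Strings that do not encode a circuit are no-instances.
WeakTournamentSource : Language
WeakTournamentSource w = ∃[ n ] ∃[ C ] w ≡ encode n C × HasSource n C

PTW : Pred Language (suc 0ℓ)
PTW L = L ≤ₚ WeakTournamentSource

S₂P : Pred Language (suc 0ℓ)
S₂P L =
  ∃[ P ] ∃[ p ] PolyTimePredicate₃ P × (∀ w →
    let Bounded : Word → Set
        Bounded z = length z ≤ ⟦ p ⟧ (length w)
    in (w ∈ L →
          ∃[ x ] Bounded x × (∀ y → Bounded y → P w x y ≡ true))
     × (¬ w ∈ L →
          ∃[ y ] Bounded y × (∀ x → Bounded x → P w x y ≡ false)))

{-# OPTIONS --safe #-}

-- Call y a refutation of x if y ≠ x and not both C(x‖y) = 1 and C(y‖x) = 0. A source
-- is a vertex without refutations, so it withstands every list of vertices. If there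
-- is no source, one short list refutes all x at once: of two distinct vertices one
-- refutes the other, so by averaging some vertex refutes or equals at least half of any
-- given set; iterating gives n + 1 vertices that refute or equal every vertex, and to
-- these one adds a refutation of each of them. Hence x certifies membership, and a list
-- of at most 2n + 2 vertices certifies non-membership.
--
-- The verifier is written as a program over stacks of bits, each of them held by one
-- tape. Its loops drain a stack while their bodies add only constantly many bits per
-- iteration, which makes time and space bounds computable from the program text. Only
-- the loop over the list of vertices is different: its body restores the stacks.
module Submission where

open import Defs
open import Data.Bool using (Bool; true; false; _∧_; _∨_; not; if_then_else_)
import Data.Bool as Bool
open import Data.Bool.Properties using (¬-not)
open import Data.Empty using (⊥-elim)
open import Data.Fin using (Fin; zero; suc; toℕ)
open import Data.Fin.Patterns
open import Data.Fin.Properties using (_≟_; 1↔⊤; +↔⊎)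
open import Data.List using (List; []; _∷_; length; map; replicate; filterᵇ; _ʳ++_) renaming (_++_ to _++ₗ_)
open import Data.List.Membership.Propositional using (find; lose) renaming (_∈_ to _∈ₗ_)
open import Data.List.Membership.Propositional.Properties using (∈-++⁺ˡ; ∈-++⁺ʳ; ∈-map⁺)
open import Data.List.Properties
  using (length-++; length-map; length-replicate; length-ʳ++; ʳ++-ʳ++; reverse-involutive)
  renaming (++-assoc to ++ₗ-assoc; ++-identityʳ to ++ₗ-identityʳ)
open import Data.List.Relation.Unary.Any using (here; there; any?)
open import Data.Maybe using (Maybe; just; nothing; maybe)
open import Data.Nat using (ℕ; zero; suc; _+_; _*_; _∸_; _⊔_; _^_; _≤_; _<_; z≤n; s≤s; _≤?_)
import Data.Nat as ℕ
open import Data.Nat.ListAction using () renaming (sum to sumₗ)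
open import Data.Nat.Properties hiding (_≟_)
open import Data.Nat.Solver using (module +-*-Solver)
open import Data.Product using (Σ; _×_; _,_; ∃-syntax; proj₁; proj₂; map₁)
open import Data.Sum using (_⊎_; inj₁; inj₂)
open import Data.Sum.Function.Propositional using (_⊎-↔_)
open import Data.Unit using (⊤; tt)
open import Data.Vec as Vec using (Vec; []; _∷_; _++_; lookup; zipWith; take; drop; sum; toList; _[_]≔_)
  renaming (map to mapᵥ; replicate to replicateᵥ)
open import Data.Vec.Properties
  using (≡-dec; toList-++; lookup-map; lookup∘update; lookup∘update′; map-[]≔; map-++; map-replicate;
         zipWith-++; []≔-commutes; []≔-idempotent; []≔-lookup)
open import Function using (_∘_)
open import Function.Bundles using (_↔_; mk↔ₛ′; module Equivalence)
open import Function.Construct.Composition using (_↔-∘_)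
open import Function.Construct.Symmetry using (↔-sym)
open import Relation.Binary.PropositionalEquality
  using (_≡_; _≢_; refl; sym; trans; cong; cong₂; subst; subst₂; module ≡-Reasoning)
open import Relation.Nullary using (¬_; Dec; yes; no; does; ¬?; _×-dec_; contradiction)
open import Relation.Nullary.Decidable using (toWitness)
open import Relation.Unary using (_⊆_)

-- Polynomials and stack programs

-- The predicate has to behave well on all bounded words, not only on meaningful certificates. So
-- every word gets a meaning: x is cut or filled up with zeros to one vertex, and y is split into
-- blocks of n + 1 bits, an incomplete last block being ignored. The extra bit of a block makes even
-- a vertex of zero bits visible, so that a challenge can also be posed when n = 0. The reduction
-- may output strings that encode no circuit. They are caught because the gate reader ends with a
-- value exactly on codes of circuits, whatever the input bits are; hence any single vertex is a
-- challenge to them. The verdict only ever changes from true to false. One bad block therefore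
-- refutes x wherever it stands, and the same y serves against all x. The machine of the reduction
-- leaves unknown contents on its tapes. Its running time bounds their size, so a bound on the
-- verifier's time in terms of the total size of its stacks is polynomial in the lengths of the
-- input and the certificates.

⟦⟧-mono : ∀ p {m n} → m ≤ n → ⟦ p ⟧ m ≤ ⟦ p ⟧ n
⟦⟧-mono (con c) m≤n = ≤-refl
⟦⟧-mono X       m≤n = m≤n
⟦⟧-mono (p ⊕ q) m≤n = +-mono-≤ (⟦⟧-mono p m≤n) (⟦⟧-mono q m≤n)
⟦⟧-mono (p ⊗ q) m≤n = *-mono-≤ (⟦⟧-mono p m≤n) (⟦⟧-mono q m≤n)

infixl 8 _⟨_⟩

_⟨_⟩ : Poly → Poly → Poly
con c   ⟨ r ⟩ = con c
X       ⟨ r ⟩ = r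
(p ⊕ q) ⟨ r ⟩ = p ⟨ r ⟩ ⊕ q ⟨ r ⟩
(p ⊗ q) ⟨ r ⟩ = p ⟨ r ⟩ ⊗ q ⟨ r ⟩

⟦⟧-⟨⟩ : ∀ p r n → ⟦ p ⟨ r ⟩ ⟧ n ≡ ⟦ p ⟧ (⟦ r ⟧ n)
⟦⟧-⟨⟩ (con c) r n = refl
⟦⟧-⟨⟩ X       r n = refl
⟦⟧-⟨⟩ (p ⊕ q) r n = cong₂ _+_ (⟦⟧-⟨⟩ p r n) (⟦⟧-⟨⟩ q r n)
⟦⟧-⟨⟩ (p ⊗ q) r n = cong₂ _*_ (⟦⟧-⟨⟩ p r n) (⟦⟧-⟨⟩ q r n)

∀-Bool? : {P : Bool → Set} → (∀ b → Dec (P b)) → Dec (∀ b → P b)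
∀-Bool? P? with P? false | P? true
... | yes pf | yes pt = yes λ { false → pf ; true → pt }
... | no ¬pf | _      = no λ p → ¬pf (p false)
... | _      | no ¬pt = no λ p → ¬pt (p true)

infixr 5 _⨾_

-- A program acts on K stacks of bits. `pop i p q` runs p if stack i is empty;
-- otherwise it pops a bit b and runs q b. `loop i p` pops bits b off stack i,
-- running p b after each of them, until the stack is empty.
data Prog (K : ℕ) : Set where
  skip : Prog K
  push : Fin K → Bool → Prog K
  _⨾_  : Prog K → Prog K → Prog K
  pop  : Fin K → Prog K → (Bool → Prog K) → Prog K
  loop : Fin K → (Bool → Prog K) → Prog K

Stacks : ℕ → Set
Stacks K = Vec Word K

size : ∀ {n} → Vec Word n → ℕ
size s = sum (mapᵥ length s)

-- The old entry is added on the left rather than subtracted on the right, as subtraction on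
-- naturals truncates.
size-update : ∀ {n} (s : Vec Word n) i u →
              size (s [ i ]≔ u) + length (lookup s i) ≡ size s + length u
size-update (w ∷ s) zero u = begin
  length u + size s + length w   ≡⟨ +-comm (length u + size s) (length w) ⟩
  length w + (length u + size s) ≡⟨ cong (length w +_) (+-comm (length u) (size s)) ⟩
  length w + (size s + length u) ≡⟨ +-assoc (length w) (size s) (length u) ⟨
  length w + size s + length u   ∎
  where open ≡-Reasoning
size-update (w ∷ s) (suc i) u = begin
  length w + size (s [ i ]≔ u) + length (lookup s i)   ≡⟨ +-assoc (length w) _ _ ⟩
  length w + (size (s [ i ]≔ u) + length (lookup s i)) ≡⟨ cong (length w +_) (size-update s i u) ⟩
  length w + (size s + length u)                       ≡⟨ +-assoc (length w) _ _ ⟨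
  length w + size s + length u                         ∎
  where open ≡-Reasoning

length-lookup≤size : ∀ {n} (s : Vec Word n) i → length (lookup s i) ≤ size s
length-lookup≤size (w ∷ s) zero    = m≤m+n _ _
length-lookup≤size (w ∷ s) (suc i) = ≤-trans (length-lookup≤size s i) (m≤n+m _ _)

caseWord : {A : Set} → A → (Bool → Word → A) → Word → A
caseWord e f []      = e
caseWord e f (b ∷ u) = f b u

≤-sum : ∀ (f : Bool → ℕ) b → f b ≤ f false + f true
≤-sum f false = m≤m+n _ _
≤-sum f true  = m≤n+m _ _

≤-branch : ∀ (f : Bool → ℕ) b → f b ≤ f false ⊔ f true
≤-branch f false = m≤m⊔n _ _
≤-branch f true  = m≤n⊔m _ _

module _ {K : ℕ} where

  private variable
    i : Fin K
    s : Stacks K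

  iterate : (Bool → Stacks K → Stacks K) → Fin K → Word → Stacks K → Stacks K
  iterate f i []      s = s
  iterate f i (b ∷ u) s = iterate f i u (f b (s [ i ]≔ u))

  run : Prog K → Stacks K → Stacks K
  run skip       s = s
  run (push i b) s = s [ i ]≔ (b ∷ lookup s i)
  run (p ⨾ q)    s = run q (run p s)
  run (pop i p q) s = caseWord (run p s) (λ b u → run (q b) (s [ i ]≔ u)) (lookup s i)
  run (loop i p) s = iterate (λ b → run (p b)) i (lookup s i) s

  iterateTime : (Bool → Stacks K → Stacks K) → (Bool → Stacks K → ℕ) →
                Fin K → Word → Stacks K → ℕ
  iterateTime f t i []      s = 1
  iterateTime f t i (b ∷ u) s =
    suc (t b (s [ i ]≔ u) + iterateTime f t i u (f b (s [ i ]≔ u)))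

  -- These are the exact step counts of the compiled program: an idle step for `skip`, two steps for
  -- a push, one for each test of a stack, and none for passing from one program to the next.
  time : Prog K → Stacks K → ℕ
  time skip       s = 1
  time (push i b) s = 2
  time (p ⨾ q)    s = time p s + time q (run p s)
  time (pop i p q) s =
    suc (caseWord (time p s) (λ b u → time (q b) (s [ i ]≔ u)) (lookup s i))
  time (loop i p) s = iterateTime (λ b → run (p b)) (λ b → time (p b)) i (lookup s i) s

  Avoids : Fin K → Prog K → Set
  Avoids i skip        = ⊤
  Avoids i (push j b)  = i ≢ j
  Avoids i (p ⨾ q)     = Avoids i p × Avoids i q
  Avoids i (pop j p q) = i ≢ j × Avoids i p × (∀ b → Avoids i (q b))
  Avoids i (loop j p)  = i ≢ j × (∀ b → Avoids i (p b))

  avoids? : ∀ i p → Dec (Avoids i p)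
  avoids? i skip        = yes tt
  avoids? i (push j b)  = ¬? (i ≟ j)
  avoids? i (p ⨾ q)     = avoids? i p ×-dec avoids? i q
  avoids? i (pop j p q) = ¬? (i ≟ j) ×-dec avoids? i p ×-dec ∀-Bool? (λ b → avoids? i (q b))
  avoids? i (loop j p)  = ¬? (i ≟ j) ×-dec ∀-Bool? (λ b → avoids? i (p b))

  -- `run` hands the remaining word of the looping stack from one iteration to the
  -- next, which agrees with the machine only if the body leaves that stack alone.
  WellFormed : Prog K → Set
  WellFormed skip        = ⊤
  WellFormed (push i b)  = ⊤
  WellFormed (p ⨾ q)     = WellFormed p × WellFormed q
  WellFormed (pop i p q) = WellFormed p × (∀ b → WellFormed (q b))
  WellFormed (loop i p)  = ∀ b → Avoids i (p b) × WellFormed (p b)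

  wellFormed? : ∀ p → Dec (WellFormed p)
  wellFormed? skip        = yes tt
  wellFormed? (push i b)  = yes tt
  wellFormed? (p ⨾ q)     = wellFormed? p ×-dec wellFormed? q
  wellFormed? (pop i p q) = wellFormed? p ×-dec ∀-Bool? (λ b → wellFormed? (q b))
  wellFormed? (loop i p)  = ∀-Bool? (λ b → avoids? i (p b) ×-dec wellFormed? (p b))

  iterate-avoids : ∀ {f} {j : Fin K} → i ≢ j → (∀ b s → lookup (f b s) i ≡ lookup s i) →
                   ∀ u s → lookup (iterate f j u s) i ≡ lookup s i
  iterate-avoids i≢j f-avoids []      s = refl
  iterate-avoids i≢j f-avoids (b ∷ u) s =
    trans (iterate-avoids i≢j f-avoids u _)
      (trans (f-avoids b _) (lookup∘update′ i≢j s u))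

  run-avoids : ∀ p → Avoids i p → ∀ s → lookup (run p s) i ≡ lookup s i
  run-avoids skip       _         s = refl
  run-avoids (push j b) i≢j       s = lookup∘update′ i≢j s _
  run-avoids (p ⨾ q)    (hp , hq) s = trans (run-avoids q hq _) (run-avoids p hp s)
  run-avoids (pop j p q) (i≢j , hp , hq) s with lookup s j
  ... | []    = run-avoids p hp s
  ... | b ∷ u = trans (run-avoids (q b) (hq b) _) (lookup∘update′ i≢j s u)
  run-avoids (loop j p) (i≢j , hp) s =
    iterate-avoids i≢j (λ b → run-avoids (p b) (hp b)) (lookup s j) s

  next-lookup : ∀ p {u} → Avoids i p → lookup (run p (s [ i ]≔ u)) i ≡ u
  next-lookup {i} {s} p {u} h = trans (run-avoids p h _) (lookup∘update i s u)

  -- Affine bounds on the total size of the stacks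

  size-push : ∀ (s : Stacks K) i b → size (s [ i ]≔ (b ∷ lookup s i)) ≡ suc (size s)
  size-push s i b = +-cancelʳ-≡ (length (lookup s i)) _ _
    (trans (size-update s i (b ∷ lookup s i)) (+-suc (size s) _))

  size-pop : ∀ (s : Stacks K) {i b u} → lookup s i ≡ b ∷ u → suc (size (s [ i ]≔ u)) ≡ size s
  size-pop s {i} {b} {u} eq = +-cancelʳ-≡ (length u) _ _ (begin
    suc (size (s [ i ]≔ u)) + length u          ≡⟨ +-suc _ (length u) ⟨
    size (s [ i ]≔ u) + length (b ∷ u)          ≡⟨ cong (λ v → size (s [ i ]≔ u) + length v) eq ⟨
    size (s [ i ]≔ u) + length (lookup s i)     ≡⟨ size-update s i u ⟩
    size s + length u                           ∎)
    where open ≡-Reasoning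

  mutual
    -- From total size m a program ends with total size at most `factor p * m + offset p`. A loop
    -- makes at most m iterations, each with a net gain of at most `surplus p`, whence the factor
    -- `suc (surplus p)`. A loop that merely moves bits has factor 1 and may thus occur inside
    -- another loop.
    factor : Prog K → ℕ
    factor skip        = 1
    factor (push i b)  = 1
    factor (p ⨾ q)     = factor q * factor p
    factor (pop i p q) = factor p ⊔ (factor (q false) ⊔ factor (q true))
    factor (loop i p)  = suc (surplus p)

    offset : Prog K → ℕ
    offset skip        = 0
    offset (push i b)  = 1
    offset (p ⨾ q)     = factor q * offset p + offset q
    offset (pop i p q) = offset p ⊔ (offset (q false) ⊔ offset (q true))
    offset (loop i p)  = 0

    -- what one iteration adds beyond the bit that it has popped
    surplus : (Bool → Prog K) → ℕ
    surplus p = (offset (p false) ⊔ offset (p true)) ∸ 1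

  -- Loop bodies may enlarge the stacks only by a constant.
  Tame : Prog K → Set
  Tame skip        = ⊤
  Tame (push i b)  = ⊤
  Tame (p ⨾ q)     = Tame p × Tame q
  Tame (pop i p q) = Tame p × (∀ b → Tame (q b))
  Tame (loop i p)  = ∀ b → factor (p b) ≡ 1 × Tame (p b)

  tame? : ∀ p → Dec (Tame p)
  tame? skip        = yes tt
  tame? (push i b)  = yes tt
  tame? (p ⨾ q)     = tame? p ×-dec tame? q
  tame? (pop i p q) = tame? p ×-dec ∀-Bool? (λ b → tame? (q b))
  tame? (loop i p)  = ∀-Bool? (λ b → (factor (p b) ℕ.≟ 1) ×-dec tame? (p b))

  -- The popped bit pays for one of the `suc c` bits that an iteration may add, so only c of them
  -- count.
  iterate-size : ∀ {f c} → (∀ b s → size (f b s) ≤ size s + suc c) →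
                 (∀ {b s u} → lookup (f b (s [ i ]≔ u)) i ≡ u) →
                 ∀ u s → lookup s i ≡ u → size (iterate f i u s) ≤ size s + length u * c
  iterate-size growth preserve [] s eq = m≤m+n _ _
  iterate-size {i} {f} {c} growth preserve (b ∷ u) s eq = begin
    size (iterate f i u s′)            ≤⟨ iterate-size growth preserve u s′ preserve ⟩
    size s′ + length u * c             ≤⟨ +-monoˡ-≤ _ (growth b _) ⟩
    size (s [ i ]≔ u) + suc c + length u * c ≡⟨ cong (_+ length u * c) (+-suc _ c) ⟩
    suc (size (s [ i ]≔ u)) + c + length u * c ≡⟨ cong (λ m → m + c + length u * c) (size-pop s eq) ⟩
    size s + c + length u * c          ≡⟨ +-assoc (size s) c _ ⟩
    size s + length (b ∷ u) * c        ∎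
    where open ≤-Reasoning
          s′ = f b (s [ i ]≔ u)

  run-size : ∀ p → WellFormed p → Tame p →
             ∀ s → size (run p s) ≤ factor p * size s + offset p

  body-size : ∀ (p : Bool → Prog K) → (∀ b → WellFormed (p b)) →
              (∀ b → factor (p b) ≡ 1 × Tame (p b)) →
              ∀ b s → size (run (p b) s) ≤ size s + suc (surplus p)
  body-size p wf tm b s = begin
    size (run (p b) s)                   ≤⟨ run-size (p b) (wf b) (proj₂ (tm b)) s ⟩
    factor (p b) * size s + offset (p b) ≡⟨ cong (λ m → m * size s + offset (p b)) (proj₁ (tm b)) ⟩
    1 * size s + offset (p b)            ≡⟨ cong (_+ offset (p b)) (*-identityˡ (size s)) ⟩
    size s + offset (p b)
      ≤⟨ +-monoʳ-≤ (size s) (≤-trans (≤-branch (offset ∘ p) b) (m≤n+m∸n _ 1)) ⟩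
    size s + suc (surplus p)             ∎
    where open ≤-Reasoning

  run-size skip wf tm s = ≤-reflexive (sym (trans (+-identityʳ _) (*-identityˡ (size s))))
  run-size (push i b) wf tm s = ≤-reflexive (begin
    size (s [ i ]≔ (b ∷ lookup s i)) ≡⟨ size-push s i b ⟩
    suc (size s)                     ≡⟨ +-comm 1 (size s) ⟩
    size s + 1                       ≡⟨ cong (_+ 1) (*-identityˡ (size s)) ⟨
    1 * size s + 1                   ∎)
    where open ≡-Reasoning
  run-size (p ⨾ q) wf tm s = begin
    size (run q (run p s))                             ≤⟨ run-size q (proj₂ wf) (proj₂ tm) _ ⟩
    factor q * size (run p s) + offset q
      ≤⟨ +-monoˡ-≤ _ (*-monoʳ-≤ (factor q) (run-size p (proj₁ wf) (proj₁ tm) s)) ⟩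
    factor q * (factor p * size s + offset p) + offset q
      ≡⟨ cong (_+ offset q) (*-distribˡ-+ (factor q) _ _) ⟩
    factor q * (factor p * size s) + factor q * offset p + offset q
      ≡⟨ +-assoc (factor q * (factor p * size s)) _ _ ⟩
    factor q * (factor p * size s) + (factor q * offset p + offset q) ≡⟨ cong (_+ (factor q * offset p + offset q)) (*-assoc (factor q) _ _) ⟨
    factor q * factor p * size s + (factor q * offset p + offset q) ∎
    where open ≤-Reasoning
  run-size (pop i p q) wf tm s with lookup s i in eq
  ... | []    = ≤-trans (run-size p (proj₁ wf) (proj₁ tm) s)
                  (+-mono-≤ (*-monoˡ-≤ (size s) (m≤m⊔n (factor p) _)) (m≤m⊔n (offset p) _))
  ... | b ∷ u = ≤-trans (run-size (q b) (proj₂ wf b) (proj₂ tm b) _)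
                  (+-mono-≤ (*-mono-≤ (≤-trans (≤-branch (factor ∘ q) b) (m≤n⊔m (factor p) _))
                                      (≤-trans (n≤1+n _) (≤-reflexive (size-pop s eq))))
                            (≤-trans (≤-branch (offset ∘ q) b) (m≤n⊔m (offset p) _)))
  run-size (loop i p) wf tm s = begin
    size (run (loop i p) s)             ≤⟨ iterate-size (body-size p (proj₂ ∘ wf) tm)
                                             (λ {b} {s} → next-lookup {s = s} (p b) (proj₁ (wf b))) _ s refl ⟩
    size s + length (lookup s i) * c    ≤⟨ +-monoʳ-≤ (size s) (*-monoˡ-≤ c (length-lookup≤size s i)) ⟩
    size s + size s * c                 ≡⟨ cong (size s +_) (*-comm (size s) c) ⟩
    suc c * size s                      ≡⟨ +-identityʳ _ ⟨
    suc c * size s + 0                  ∎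
    where open ≤-Reasoning
          c = surplus p

  -- The second of two programs is charged at the size that the first may leave, and a loop body at
  -- the largest size that the loop can reach. Alternatives are added up because `Poly` has no
  -- maximum.
  timeBound : Prog K → Poly
  timeBound skip        = con 1
  timeBound (push i b)  = con 2
  timeBound (p ⨾ q)     = timeBound p ⊕ timeBound q ⟨ con (factor p) ⊗ X ⊕ con (offset p) ⟩
  timeBound (pop i p q) = con 1 ⊕ (timeBound p ⊕ (timeBound (q false) ⊕ timeBound (q true)))
  timeBound (loop i p)  =
    con 1 ⊕ X ⊗ (con 1 ⊕ (timeBound (p false) ⊕ timeBound (p true)) ⟨ con (suc (surplus p)) ⊗ X ⟩)

  -- The invariant is left open because two kinds of loops rely on it: those with a constant gain
  -- per iteration, and the loop over the challenge, whose states are known explicitly.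
  iterate-time : ∀ {f t} {i : Fin K} (Inv : Word → Stacks K → Set) {B} →
                 (∀ b u s → Inv (b ∷ u) s →
                    t b (s [ i ]≔ u) ≤ B × Inv u (f b (s [ i ]≔ u))) →
                 ∀ u s → Inv u s → iterateTime f t i u s ≤ 1 + length u * suc B
  iterate-time Inv step []      s inv = ≤-refl
  iterate-time Inv step (b ∷ u) s inv =
    let t≤B , inv′ = step b u s inv
    in s≤s (≤-trans (+-mono-≤ t≤B (iterate-time Inv step u _ inv′))
                    (≤-reflexive (+-suc _ _)))

  run-time : ∀ p → WellFormed p → Tame p →
             ∀ s {N} → size s ≤ N → time p s ≤ ⟦ timeBound p ⟧ N
  run-time skip       wf tm s s≤N = ≤-refl
  run-time (push i b) wf tm s s≤N = ≤-refl
  run-time (p ⨾ q) wf tm s {N} s≤N =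
    +-mono-≤ (run-time p (proj₁ wf) (proj₁ tm) s s≤N)
      (≤-trans
        (run-time q (proj₂ wf) (proj₂ tm) (run p s)
          (≤-trans (run-size p (proj₁ wf) (proj₁ tm) s)
                   (+-monoˡ-≤ _ (*-monoʳ-≤ (factor p) s≤N))))
        (≤-reflexive (sym (⟦⟧-⟨⟩ (timeBound q) _ N))))
  run-time (pop i p q) wf tm s s≤N with lookup s i in eq
  ... | []    = s≤s (≤-trans (run-time p (proj₁ wf) (proj₁ tm) s s≤N) (m≤m+n _ _))
  ... | b ∷ u = s≤s (≤-trans
                  (run-time (q b) (proj₂ wf b) (proj₂ tm b) _
                    (≤-trans (n≤1+n _) (≤-trans (≤-reflexive (size-pop s eq)) s≤N)))
                  (≤-trans (≤-sum (λ b → ⟦ timeBound (q b) ⟧ _) b) (m≤n+m _ (⟦ timeBound p ⟧ _))))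
  run-time (loop i p) wf tm s {N} s≤N = begin
    iterateTime (run ∘ p) (time ∘ p) i (lookup s i) s
      ≤⟨ iterate-time Inv step (lookup s i) s (refl , ≤-trans
           (+-mono-≤ s≤N (≤-trans (*-monoˡ-≤ c (≤-trans (length-lookup≤size s i) s≤N)) (≤-reflexive (*-comm N c)))) ≤-refl) ⟩
    1 + length (lookup s i) * suc (⟦ body ⟧ (suc c * N))
      ≤⟨ s≤s (*-mono-≤ (≤-trans (length-lookup≤size s i) s≤N)
                       (≤-reflexive (cong suc (sym (⟦⟧-⟨⟩ body (con (suc c) ⊗ X) N))))) ⟩
    1 + N * suc (⟦ body ⟨ con (suc c) ⊗ X ⟩ ⟧ N) ∎
    where
    open ≤-Reasoning
    c = surplus p
    body = timeBound (p false) ⊕ timeBound (p true)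
    -- A potential: each bit still to be popped reserves the c bits that its iteration may add, so
    -- the bound `suc c * N` survives all iterations.
    Inv : Word → Stacks K → Set
    Inv u s = lookup s i ≡ u × size s + length u * c ≤ suc c * N
    step : ∀ b u s → Inv (b ∷ u) s →
           time (p b) (s [ i ]≔ u) ≤ ⟦ body ⟧ (suc c * N) × Inv u (run (p b) (s [ i ]≔ u))
    step b u s (eq , s≤) =
      ≤-trans (run-time (p b) (proj₂ (wf b)) (proj₂ (tm b)) _
                (≤-trans (n≤1+n _) (≤-trans (≤-reflexive (size-pop s eq)) (≤-trans (m≤m+n _ _) s≤))))
              (≤-sum (λ b → ⟦ timeBound (p b) ⟧ _) b)
      , next-lookup {s = s} (p b) (proj₁ (wf b))
      , (begin
          size (run (p b) (s [ i ]≔ u)) + length u * c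
            ≤⟨ +-monoˡ-≤ _ (body-size p (proj₂ ∘ wf) tm b _) ⟩
          size (s [ i ]≔ u) + suc c + length u * c    ≡⟨ cong (_+ length u * c) (+-suc _ c) ⟩
          suc (size (s [ i ]≔ u)) + c + length u * c  ≡⟨ cong (λ m → m + c + length u * c) (size-pop s eq) ⟩
          size s + c + length u * c                   ≡⟨ +-assoc (size s) c _ ⟩
          size s + length (b ∷ u) * c                 ≤⟨ s≤ ⟩
          suc c * N                                   ∎)

-- Records rather than equations, so that stating a run does not unfold it.
record Runs {K} (p : Prog K) (s s′ : Stacks K) : Set where
  constructor ran
  field result : run p s ≡ s′

open Runs public

record Within {K} (r : Poly) (N : ℕ) (p : Prog K) (s : Stacks K) : Set where
  constructor within
  field bound : time p s ≤ ⟦ r ⟧ N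

open Within public

-- Compiling stack programs to control tables

Finite : Set → Set
Finite A = ∃[ n ] (A ↔ Fin n)

⊤-finite : Finite ⊤
⊤-finite = 1 , ↔-sym 1↔⊤

_⊎-finite_ : ∀ {A B} → Finite A → Finite B → Finite (A ⊎ B)
(m , f) ⊎-finite (n , g) = m + n , ↔-sym +↔⊎ ↔-∘ (f ⊎-↔ g)

Bool×-finite : ∀ {P : Bool → Set} → Finite (P false) → Finite (P true) → Finite (Σ Bool P)
Bool×-finite {P} f g with f ⊎-finite g
... | n , h = n , h ↔-∘ mk↔ₛ′ to from to∘from from∘to
  where
  to : Σ Bool P → P false ⊎ P true
  to (false , x) = inj₁ x
  to (true  , x) = inj₂ x
  from : P false ⊎ P true → Σ Bool P
  from (inj₁ x) = false , x
  from (inj₂ x) = true , x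
  to∘from : ∀ x → to (from x) ≡ x
  to∘from (inj₁ x) = refl
  to∘from (inj₂ x) = refl
  from∘to : ∀ x → from (to x) ≡ x
  from∘to (false , x) = refl
  from∘to (true  , x) = refl

module _ {g : ℕ} where

  idle : ∀ {k} → Vec (Symbol g) k → Vec (Symbol g × Move) k
  idle = mapᵥ (_, stay)

  -- Every symbol other than a bit ends a stack, in agreement with `readTape`. This lets the tapes
  -- left behind by an arbitrary machine serve as stacks.
  onBit : {A : Set} → (Bool → A) → A → Symbol g → A
  onBit f e (bit b) = f b
  onBit f e □       = e
  onBit f e (aux _) = e

  perform : ∀ {k} → Vec (Symbol g × Move) k → Vec (Tape g) k → Vec (Tape g) k
  perform = zipWith act

  perform-idle : ∀ {k} (ts : Vec (Tape g) k) → perform (idle (mapᵥ head ts)) ts ≡ ts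
  perform-idle []       = refl
  perform-idle (t ∷ ts) = cong (t ∷_) (perform-idle ts)

  perform-idle-update : ∀ {k} (ts : Vec (Tape g) k) i a →
    perform (idle (mapᵥ head ts) [ i ]≔ a) ts ≡ ts [ i ]≔ act a (lookup ts i)
  perform-idle-update (t ∷ ts) zero    a = cong (act a t ∷_) (perform-idle ts)
  perform-idle-update (t ∷ ts) (suc i) a = cong (t ∷_) (perform-idle-update ts i a)

  readTape-goRight : ∀ {t : Tape g} {b c u} → readTape t ≡ b ∷ u → readTape (act (c , goRight) t) ≡ u
  readTape-goRight {tape _ (bit _) []}      refl = refl
  readTape-goRight {tape _ (bit _) (_ ∷ _)} refl = refl

  -- An action writes before it moves, so a push takes two: one rewrites the old top and moves left,
  -- the next overwrites whatever the cell there contains.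
  readTape-push : ∀ (t : Tape g) b →
                  readTape (act (bit b , stay) (act (head t , goLeft) t)) ≡ b ∷ readTape t
  readTape-push (tape []      h rs) b = refl
  readTape-push (tape (_ ∷ _) h rs) b = refl

  onBit-∷ : ∀ {A : Set} {f : Bool → A} {e} t {b u} → readTape t ≡ b ∷ u →
            onBit f e (head t) ≡ f b
  onBit-∷ (tape _ (bit _) _) refl = refl

  onBit-[] : ∀ {A : Set} {f : Bool → A} {e} t → readTape t ≡ [] → onBit f e (head t) ≡ e
  onBit-[] (tape _ □ _)       eq = refl
  onBit-[] (tape _ (aux _) _) eq = refl

module _ {K : ℕ} where

  Control : Prog K → Set
  Control skip        = ⊤
  Control (push i b)  = ⊤ ⊎ ⊤
  Control (p ⨾ q)     = Control p ⊎ Control q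
  Control (pop i p q) = ⊤ ⊎ (Control p ⊎ Σ Bool (λ b → Control (q b)))
  Control (loop i p)  = ⊤ ⊎ Σ Bool (λ b → Control (p b))

  control-finite : ∀ p → Finite (Control p)
  control-finite skip        = ⊤-finite
  control-finite (push i b)  = ⊤-finite ⊎-finite ⊤-finite
  control-finite (p ⨾ q)     = control-finite p ⊎-finite control-finite q
  control-finite (pop i p q) =
    ⊤-finite ⊎-finite (control-finite p ⊎-finite
      Bool×-finite (control-finite (q false)) (control-finite (q true)))
  control-finite (loop i p)  =
    ⊤-finite ⊎-finite Bool×-finite (control-finite (p false)) (control-finite (p true))

  entry : ∀ p → Control p
  entry skip        = tt
  entry (push i b)  = inj₁ tt
  entry (p ⨾ q)     = inj₁ (entry p)
  entry (pop i p q) = inj₁ tt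
  entry (loop i p)  = inj₁ tt

  module _ {g : ℕ} where

    Heads Acts TapeVec : Set
    Heads   = Vec (Symbol g) K
    Acts    = Vec (Symbol g × Move) K
    TapeVec = Vec (Tape g) K

    heads : TapeVec → Heads
    heads = mapᵥ head

    only : Fin K → Symbol g × Move → Heads → Acts
    only i a hs = idle hs [ i ]≔ a

    -- a control point to continue from, or nothing when the program exits
    Transition : Set → Set
    Transition Q = Q → Heads → Maybe Q × Acts

    then : {A B : Set} → (A → B) → Maybe B → Maybe A → Maybe B
    then f k = maybe (just ∘ f) k

    control : ∀ p → Transition (Control p)
    control skip       _        hs = nothing , idle hs
    control (push i b) (inj₁ _) hs = just (inj₂ tt) , only i (lookup hs i , goLeft) hs
    control (push i b) (inj₂ _) hs = nothing , only i (bit b , stay) hs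
    control (p ⨾ q)    (inj₁ x) hs = map₁ (then inj₁ (just (inj₂ (entry q)))) (control p x hs)
    control (p ⨾ q)    (inj₂ x) hs = map₁ (then inj₂ nothing) (control q x hs)
    control (pop i p q) (inj₁ _) hs =
      onBit (λ b → just (inj₂ (inj₂ (b , entry (q b)))) , only i (bit b , goRight) hs)
            (just (inj₂ (inj₁ (entry p))) , idle hs)
            (lookup hs i)
    control (pop i p q) (inj₂ (inj₁ x)) hs = map₁ (then (inj₂ ∘ inj₁) nothing) (control p x hs)
    control (pop i p q) (inj₂ (inj₂ (b , x))) hs =
      map₁ (then (λ y → inj₂ (inj₂ (b , y))) nothing) (control (q b) x hs)
    control (loop i p) (inj₁ _) hs =
      onBit (λ b → just (inj₂ (b , entry (p b))) , only i (bit b , goRight) hs)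
            (nothing , idle hs)
            (lookup hs i)
    control (loop i p) (inj₂ (b , x)) hs =
      map₁ (then (λ y → inj₂ (b , y)) (just (inj₁ tt))) (control (p b) x hs)

    data Exits {Q : Set} (δ : Transition Q) : ℕ → Q → TapeVec → TapeVec → Set where
      exit     : ∀ {q ts as ts′} → δ q (heads ts) ≡ (nothing , as) →
             perform as ts ≡ ts′ → Exits δ 1 q ts ts′
      continue : ∀ {n q ts q′ as ts′ ts″} → δ q (heads ts) ≡ (just q′ , as) →
             perform as ts ≡ ts′ → Exits δ n q′ ts′ ts″ → Exits δ (suc n) q ts ts″

    module _ {Q Q′ : Set} {δ : Transition Q} {δ′ : Transition Q′} (f : Q → Q′) where

      embed-exit : (∀ q hs → δ′ (f q) hs ≡ map₁ (then f nothing) (δ q hs)) →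
                   ∀ {n q ts ts′} → Exits δ n q ts ts′ → Exits δ′ n (f q) ts ts′
      embed-exit h (exit e eq)  = exit (trans (h _ _) (cong (map₁ (then f nothing)) e)) eq
      embed-exit h (continue e eq es) = continue (trans (h _ _) (cong (map₁ (then f nothing)) e)) eq (embed-exit h es)

      -- The exit step of the first program performs its last actions and enters the second one at
      -- the same time, so the step counts add up exactly.
      embed-then : ∀ {q₂} → (∀ q hs → δ′ (f q) hs ≡ map₁ (then f (just q₂)) (δ q hs)) →
                   ∀ {m n q ts ts′ ts″} → Exits δ m q ts ts′ → Exits δ′ n q₂ ts′ ts″ →
                   Exits δ′ (m + n) (f q) ts ts″
      embed-then {q₂} h (exit e eq)  es₂ = continue (trans (h _ _) (cong (map₁ (then f (just q₂))) e)) eq es₂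
      embed-then {q₂} h (continue e eq es) es₂ =
        continue (trans (h _ _) (cong (map₁ (then f (just q₂))) e)) eq (embed-then h es es₂)

    -- A tape holds the stack whose top is under the head; the cells to the left of
    -- the head and those beyond the first non-bit on its right are irrelevant.
    stacks : TapeVec → Stacks K
    stacks = mapᵥ readTape

    stacks-update : ∀ {ts s i t u} → stacks ts ≡ s → readTape t ≡ u →
                    stacks (ts [ i ]≔ t) ≡ s [ i ]≔ u
    stacks-update {ts} {i = i} refl refl = map-[]≔ readTape ts i

    lookup-stacks : ∀ {ts s} i → stacks ts ≡ s → readTape (lookup ts i) ≡ lookup s i
    lookup-stacks {ts} i refl = sym (lookup-map i readTape ts)

    onBit-heads-∷ : ∀ {A : Set} {f : Bool → A} {e} ts i {b u} → readTape (lookup ts i) ≡ b ∷ u →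
                    onBit f e (lookup (heads ts) i) ≡ f b
    onBit-heads-∷ ts i eq rewrite lookup-map i head ts = onBit-∷ (lookup ts i) eq

    onBit-heads-[] : ∀ {A : Set} {f : Bool → A} {e} ts i → readTape (lookup ts i) ≡ [] →
                     onBit f e (lookup (heads ts) i) ≡ e
    onBit-heads-[] ts i eq rewrite lookup-map i head ts = onBit-[] (lookup ts i) eq

    Simulates : Prog K → Set
    Simulates p = ∀ {ts s} → stacks ts ≡ s →
      ∃[ ts′ ] Exits (control p) (time p s) (entry p) ts ts′ × stacks ts′ ≡ run p s

    simulates-loop : ∀ i (p : Bool → Prog K) → (∀ b → Simulates (p b)) → (∀ b → Avoids i (p b)) →
      ∀ u {ts s} → stacks ts ≡ s → lookup s i ≡ u →
      ∃[ ts′ ] Exits (control (loop i p)) (iterateTime (run ∘ p) (time ∘ p) i u s) (inj₁ tt) ts ts′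
             × stacks ts′ ≡ iterate (run ∘ p) i u s
    simulates-loop i p sim av [] {ts} eq eqᵢ =
      ts , exit (onBit-heads-[] ts i (trans (lookup-stacks i eq) eqᵢ)) (perform-idle ts) , eq
    simulates-loop i p sim av (b ∷ u) {ts} {s} eq eqᵢ =
      let readᵢ = trans (lookup-stacks i eq) eqᵢ
          ts₁ , es₁ , eq₁ = sim b (stacks-update {ts} {s} {i} eq (readTape-goRight {c = bit b} readᵢ))
          ts₂ , es₂ , eq₂ = simulates-loop i p sim av u eq₁ (next-lookup {s = s} (p b) (av b))
      in ts₂ , continue (onBit-heads-∷ ts i readᵢ) (perform-idle-update ts i _)
                  (embed-then (λ x → inj₂ (b , x)) (λ _ _ → refl) es₁ es₂) , eq₂

    simulates : ∀ p → WellFormed p → Simulates p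
    simulates skip wf {ts} eq = ts , exit refl (perform-idle ts) , eq
    simulates (push i b) wf {ts} {s} eq =
      ts₂ , continue refl (trans (perform-idle-update ts i _)
                           (cong (λ h → ts [ i ]≔ act (h , goLeft) (lookup ts i)) (lookup-map i head ts)))
               (exit refl (perform-idle-update ts₁ i _))
          , trans (stacks-update {ts₁} {stacks ts₁} {i} refl
                    (trans (cong (λ t → readTape (act (bit b , stay) t)) (lookup∘update i ts _))
                           (readTape-push (lookup ts i) b)))
              (trans (cong (_[ i ]≔ (b ∷ readTape (lookup ts i))) (map-[]≔ readTape ts i))
              (trans (update-update (stacks ts))
                 (trans (cong (λ w → stacks ts [ i ]≔ (b ∷ w)) (lookup-stacks {ts} i refl))
                 (cong (λ s → s [ i ]≔ (b ∷ lookup s i)) eq))))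
      where
      ts₁ = ts [ i ]≔ act (head (lookup ts i) , goLeft) (lookup ts i)
      ts₂ = ts₁ [ i ]≔ act (bit b , stay) (lookup ts₁ i)
      update-update : ∀ {x y} (s : Stacks K) → (s [ i ]≔ x) [ i ]≔ y ≡ s [ i ]≔ y
      update-update s = []≔-idempotent s i
    simulates (p ⨾ q) (wp , wq) eq =
      let ts₁ , es₁ , eq₁ = simulates p wp eq
          ts₂ , es₂ , eq₂ = simulates q wq eq₁
      in ts₂ , embed-then inj₁ (λ _ _ → refl) es₁ (embed-exit inj₂ (λ _ _ → refl) es₂) , eq₂
    simulates (pop i p q) (wp , wq) {ts} {s} eq with lookup s i in eqᵢ
    ... | [] =
      let ts₁ , es₁ , eq₁ = simulates p wp eq
      in ts₁ , continue (onBit-heads-[] ts i (trans (lookup-stacks i eq) eqᵢ)) (perform-idle ts)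
                  (embed-exit (inj₂ ∘ inj₁) (λ _ _ → refl) es₁) , eq₁
    ... | b ∷ u =
      let readᵢ = trans (lookup-stacks i eq) eqᵢ
          ts₁ , es₁ , eq₁ = simulates (q b) (wq b)
            (stacks-update {ts} {s} {i} eq (readTape-goRight {c = bit b} readᵢ))
      in ts₁ , continue (onBit-heads-∷ ts i readᵢ) (perform-idle-update ts i _)
                  (embed-exit (λ x → inj₂ (inj₂ (b , x))) (λ _ _ → refl) es₁) , eq₁
    simulates (loop i p) wf {s = s} eq =
      simulates-loop i p (λ b → simulates (p b) (proj₂ (wf b))) (proj₁ ∘ wf) (lookup s i) eq refl

-- Running a program on the output of a machine

module _ {a : ℕ} (M : TM a) where
  open TM M

  HaltsWithin-mono : ∀ {m n c ts} → m ≤ n → HaltsWithin m c ts → HaltsWithin n c ts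
  HaltsWithin-mono m≤n       (halt e)   = halt e
  HaltsWithin-mono (s≤s m≤n) (next e h) = next e (HaltsWithin-mono m≤n h)

module _ {g : ℕ} where

  cells : Tape g → ℕ
  cells t = length (left t) + suc (length (right t))

  totalCells : ∀ {k} → Vec (Tape g) k → ℕ
  totalCells ts = sum (mapᵥ cells ts)

  -- Since both sides of the head are counted, a move is neutral unless it leaves the listed cells,
  -- and then it adds a single blank.
  cells-act : ∀ a t → cells (act a t) ≤ suc (cells t)
  cells-act (s , goLeft)  (tape [] h rs)       = ≤-refl
  cells-act (s , goLeft)  (tape (l ∷ ls) h rs) = ≤-trans (≤-reflexive (+-suc (length ls) _)) (n≤1+n _)
  cells-act (s , goRight) (tape ls h [])       = ≤-refl
  cells-act (s , goRight) (tape ls h (r ∷ rs)) = ≤-trans (≤-reflexive (sym (+-suc (length ls) _))) (n≤1+n _)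
  cells-act (s , stay)    (tape ls h rs)       = n≤1+n _

  totalCells-perform : ∀ {k} (as : Vec (Symbol g × Move) k) ts →
                       totalCells (zipWith act as ts) ≤ totalCells ts + k
  totalCells-perform []       []       = z≤n
  totalCells-perform {suc k} (a ∷ as) (t ∷ ts) = begin
    cells (act a t) + totalCells (zipWith act as ts)
      ≤⟨ +-mono-≤ (cells-act a t) (totalCells-perform as ts) ⟩
    suc (cells t) + (totalCells ts + k)              ≡⟨ cong suc (+-assoc (cells t) _ k) ⟨
    suc (cells t + totalCells ts + k)                ≡⟨ +-suc _ k ⟨
    cells t + totalCells ts + suc k                  ∎
    where open ≤-Reasoning

  length-leadingBits : ∀ (ss : List (Symbol g)) → length (leadingBits ss) ≤ length ss
  length-leadingBits []           = z≤n
  length-leadingBits (□ ∷ ss)     = z≤n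
  length-leadingBits (bit b ∷ ss) = s≤s (length-leadingBits ss)
  length-leadingBits (aux _ ∷ ss) = z≤n

  length-readTape : ∀ (t : Tape g) → length (readTape t) ≤ cells t
  length-readTape t = ≤-trans (length-leadingBits (head t ∷ right t)) (m≤n+m _ (length (left t)))

  size-readTape : ∀ {k} (ts : Vec (Tape g) k) → size (mapᵥ readTape ts) ≤ totalCells ts
  size-readTape []       = z≤n
  size-readTape (t ∷ ts) = +-mono-≤ (length-readTape t) (size-readTape ts)

  cells-inputTape : ∀ w → cells (inputTape {g} w) ≤ suc (length w)
  cells-inputTape []      = ≤-refl
  cells-inputTape (b ∷ w) = s≤s (≤-trans (≤-reflexive (length-map bit w)) (n≤1+n _))

  readTape-inputTape : ∀ w → readTape (inputTape {g} w) ≡ w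
  readTape-inputTape []      = refl
  readTape-inputTape (b ∷ w) = cong (b ∷_) (bits w)
    where
    bits : ∀ w → leadingBits {g} (map bit w) ≡ w
    bits []      = refl
    bits (b ∷ w) = cong (b ∷_) (bits w)

  totalCells-blank : ∀ k → totalCells (replicateᵥ k (blankTape {g})) ≡ k
  totalCells-blank zero    = refl
  totalCells-blank (suc k) = cong suc (totalCells-blank k)

size-++ : ∀ {m n} (s : Vec Word m) (s′ : Vec Word n) → size (s ++ s′) ≡ size s + size s′
size-++ []      s′ = refl
size-++ (w ∷ s) s′ = trans (cong (length w +_) (size-++ s s′)) (sym (+-assoc (length w) _ _))

size-replicate-[] : ∀ k → size (replicateᵥ k []) ≡ 0
size-replicate-[] zero    = refl
size-replicate-[] (suc k) = size-replicate-[] k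

-- Space is bounded by time. This controls both the output of the reduction and the remains on its
-- other tapes.
totalCells-halts : ∀ {a} (M : TM a) → let open TM M in ∀ {t q ts ts′} →
  HaltsWithin t (q , ts) ts′ → totalCells ts′ ≤ totalCells ts + t * #tapes
totalCells-halts M (TM.halt e) = m≤m+n _ _
totalCells-halts M {suc t} {q} {ts} {ts′} (TM.next e h) with TM.δ M q (mapᵥ head ts)
totalCells-halts M {suc t} {q} {ts} {ts′} (TM.next refl h) | just (q′ , as) = begin
  totalCells ts′                                 ≤⟨ totalCells-halts M h ⟩
  totalCells (zipWith act as ts) + t * #tapes    ≤⟨ +-monoˡ-≤ _ (totalCells-perform as ts) ⟩
  totalCells ts + #tapes + t * #tapes            ≡⟨ +-assoc (totalCells ts) _ _ ⟩
  totalCells ts + suc t * #tapes                 ∎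
  where open ≤-Reasoning
        open TM M using (#tapes)

-- The machine runs M on its second and fifth tapes and on the last ones. It then runs
-- a stack program that finds M's output on stack 4.
module Compose (M : TM 1) (k : ℕ) (p : Prog (5 + (k + TM.#work M))) (wf : WellFormed p) where
  open TM M using (#work; #aux)

  K : ℕ
  K = 5 + (k + #work)

  composed : TM 3
  composed = record
    { State   = TM.State M ⊎ (Control p ⊎ ⊤)
    ; #states = proj₁ states
    ; finite  = proj₂ states
    ; #aux    = #aux
    -- The additional tape plays the output tape of M; the output tape of the composed machine stays
    -- blank for the program.
    ; #work   = suc (k + #work)
    ; start   = inj₁ (TM.start M)
    ; δ       = δ
    }
    where
    states : Finite (TM.State M ⊎ (Control p ⊎ ⊤))
    states = (TM.#states M , TM.finite M) ⊎-finite (control-finite p ⊎-finite ⊤-finite)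
    δ : TM.State M ⊎ (Control p ⊎ ⊤) → Vec (Symbol #aux) K →
        Maybe ((TM.State M ⊎ (Control p ⊎ ⊤)) × Vec (Symbol #aux × Move) K)
    δ (inj₁ q) hs@(o ∷ w ∷ x ∷ y ∷ m ∷ hs′) with TM.δ M q (m ∷ w ∷ drop k hs′)
    -- M halts without acting, so one idle step hands over to the program; it is the `suc` in
    -- `t + suc n` below.
    ... | nothing = just (inj₂ (inj₁ (entry p)) , idle hs)
    ... | just (q′ , aₘ ∷ a_w ∷ as) =
      just (inj₁ q′ , (o , stay) ∷ a_w ∷ (x , stay) ∷ (y , stay) ∷ aₘ ∷ (idle (take k hs′) ++ as))
    δ (inj₂ (inj₁ c)) hs = let q , as = control p c hs in just (inj₂ (maybe inj₁ (inj₂ tt) q) , as)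
    δ (inj₂ (inj₂ _)) hs = nothing

  module C = TM composed

  next-config : Vec (Tape #aux) K → Maybe (Control p) × Acts → Maybe C.Config
  next-config ts (q , as) = just (inj₂ (maybe inj₁ (inj₂ tt) q) , perform as ts)

  runs-program : ∀ {n c ts ts′} → Exits (control p) n c ts ts′ →
                 C.HaltsWithin n (inj₂ (inj₁ c) , ts) ts′
  runs-program {ts = ts} (exit e refl)        = C.next (cong (next-config ts) e) (C.halt refl)
  runs-program {ts = ts} (continue e refl es) = C.next (cong (next-config ts) e) (runs-program es)

  drop-heads : ∀ {k n} (ss : Vec (Tape #aux) k) (ts : Vec (Tape #aux) n) →
               drop k (mapᵥ head (ss ++ ts)) ≡ mapᵥ head ts
  drop-heads []       ts = refl
  drop-heads (s ∷ ss) ts = drop-heads ss ts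

  take-heads : ∀ {k n} (ss : Vec (Tape #aux) k) (ts : Vec (Tape #aux) n) →
               take k (mapᵥ head (ss ++ ts)) ≡ mapᵥ head ss
  take-heads []       ts = refl
  take-heads (s ∷ ss) ts = cong (head s ∷_) (take-heads ss ts)

  module _ (o x y : Tape #aux) (ss : Vec (Tape #aux) k) where

    place : Vec (Tape #aux) (2 + #work) → Vec (Tape #aux) K
    place (m ∷ w ∷ ws) = o ∷ w ∷ x ∷ y ∷ m ∷ (ss ++ ws)

    step-finished : ∀ q ts → TM.step M (q , ts) ≡ nothing →
      C.step (inj₁ q , place ts) ≡ just (inj₂ (inj₁ (entry p)) , place ts)
    step-finished q (m ∷ w ∷ ws) e rewrite drop-heads ss ws with TM.δ M q (head m ∷ head w ∷ mapᵥ head ws)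
    ... | nothing = cong (λ ts → just (inj₂ (inj₁ (entry p)) , ts)) (perform-idle (place (m ∷ w ∷ ws)))

    step-running : ∀ q ts {q′ ts′} → TM.step M (q , ts) ≡ just (q′ , ts′) →
      C.step (inj₁ q , place ts) ≡ just (inj₁ q′ , place ts′)
    step-running q (m ∷ w ∷ ws) e
      rewrite drop-heads ss ws
      with TM.δ M q (head m ∷ head w ∷ mapᵥ head ws)
    step-running q (m ∷ w ∷ ws) refl | just (q′ , aₘ ∷ a_w ∷ as) =
      cong (λ ts → just (inj₁ q′ , o ∷ act a_w w ∷ x ∷ y ∷ act aₘ m ∷ ts))
        (trans (cong (λ hs → zipWith act (idle hs ++ as) (ss ++ ws)) (take-heads ss ws))
        (trans (zipWith-++ act (idle (mapᵥ head ss)) as ss ws)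
               (cong (_++ zipWith act as ws) (perform-idle ss))))

    runs-M : ∀ {t n q ts ts′ ts″} → TM.HaltsWithin M t (q , ts) ts′ →
             C.HaltsWithin n (inj₂ (inj₁ (entry p)) , place ts′) ts″ →
             C.HaltsWithin (t + suc n) (inj₁ q , place ts) ts″
    runs-M {t} {n} {q} {ts} (TM.halt e) h =
      HaltsWithin-mono composed (m≤n+m (suc n) t) (C.next (step-finished q ts e) h)
    runs-M {q = q} {ts} (TM.next e h′) h = C.next (step-running q ts e) (runs-M h′ h)

  -- Stack 1 and the last stacks hold whatever M has left on its tapes.
  start : Word → Word → Word → Word → Vec Word #work → Stacks K
  start w x y v ws = [] ∷ w ∷ x ∷ y ∷ v ∷ (replicateᵥ k [] ++ ws)

  -- Of what M leaves on its input and work tapes only the size is known: `length w` and one head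
  -- cell for each of its `2 + #work` tapes at the start, then at most one new cell per tape and
  -- step. The remains are therefore existential, and the program has to cope with any of them.
  composed-correct : ∀ {t w tsₘ} x y → TM.HaltsWithin M t (TM.initial M (w ∷ [])) tsₘ →
    ∃[ w′ ] ∃[ ws ]
      size (start w′ x y (TM.output M tsₘ) ws)
        ≤ length w + (length x + length y) + suc t * (2 + #work)
    × (∀ {r N s} → Within r N p (start w′ x y (TM.output M tsₘ) ws) → Runs p (start w′ x y (TM.output M tsₘ) ws) s →
         ∃[ ts ] C.HaltsWithin (t + suc (⟦ r ⟧ N)) (C.initial (w ∷ x ∷ y ∷ [])) ts × mapᵥ readTape ts ≡ s)
  composed-correct {t} {w} {tsₘ@(m ∷ w′ ∷ ws)} x y halts = readTape w′ , mapᵥ readTape ws , size-bound , runs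
    where
    placed : Vec (Tape #aux) K
    placed = place blankTape (inputTape x) (inputTape y) (replicateᵥ k blankTape) tsₘ

    placed-stacks : mapᵥ readTape placed ≡ start (readTape w′) x y (readTape m) (mapᵥ readTape ws)
    placed-stacks
      rewrite readTape-inputTape {#aux} x | readTape-inputTape {#aux} y
            | map-++ readTape (replicateᵥ k (blankTape {#aux})) ws
            | map-replicate readTape (blankTape {#aux}) k = refl

    initial-placed : C.initial (w ∷ x ∷ y ∷ []) ≡
      (inj₁ (TM.start M) , place blankTape (inputTape x) (inputTape y) (replicateᵥ k blankTape)
                             (proj₂ (TM.initial M (w ∷ []))))
    initial-placed = cong (λ ts → inj₁ (TM.start M) , blankTape ∷ inputTape w ∷ inputTape x ∷ inputTape y ∷ blankTape ∷ ts)
      (blanks k)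
      where
      blanks : ∀ k → replicateᵥ (k + #work) (blankTape {#aux}) ≡ replicateᵥ k blankTape ++ replicateᵥ #work blankTape
      blanks zero    = refl
      blanks (suc k) = cong (blankTape ∷_) (blanks k)

    size-bound : size (start (readTape w′) x y (readTape m) (mapᵥ readTape ws))
                   ≤ length w + (length x + length y) + suc t * (2 + #work)
    size-bound = begin
      lw + (lx + (ly + (lm + size (replicateᵥ k [] ++ mapᵥ readTape ws))))
        ≡⟨ cong (λ z → lw + (lx + (ly + (lm + z)))) (trans (size-++ (replicateᵥ k []) _) (cong (_+ lws) (size-replicate-[] k))) ⟩
      lw + (lx + (ly + (lm + lws)))
        ≡⟨ solve 5 (λ lw lx ly lm lws → lw :+ (lx :+ (ly :+ (lm :+ lws))) := lx :+ ly :+ (lm :+ (lw :+ lws))) refl lw lx ly lm lws ⟩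
      lx + ly + (lm + (lw + lws))
        ≤⟨ +-monoʳ-≤ (lx + ly) (≤-trans (size-readTape tsₘ) (totalCells-halts M halts)) ⟩
      lx + ly + (suc (cells (inputTape {#aux} w) + totalCells (replicateᵥ #work (blankTape {#aux}))) + t * (2 + #work))
        ≤⟨ +-monoʳ-≤ (lx + ly) (+-monoˡ-≤ (t * (2 + #work)) (s≤s (+-mono-≤ (cells-inputTape w) (≤-reflexive (totalCells-blank #work))))) ⟩
      lx + ly + (suc (suc (length w) + #work) + t * (2 + #work))
        ≡⟨ solve 5 (λ lx ly l k t → lx :+ ly :+ (con 2 :+ l :+ k :+ t) := l :+ (lx :+ ly) :+ (con 2 :+ k :+ t)) refl lx ly (length w) #work _ ⟩
      length w + (lx + ly) + suc t * (2 + #work) ∎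
      where
      open ≤-Reasoning
      open +-*-Solver using (solve; _:+_; _:=_; con)
      lw = length (readTape w′)
      lx = length x
      ly = length y
      lm = length (readTape m)
      lws = size (mapᵥ readTape ws)

    runs : ∀ {r N s} → Within r N p (start (readTape w′) x y (readTape m) (mapᵥ readTape ws)) →
           Runs p (start (readTape w′) x y (readTape m) (mapᵥ readTape ws)) s →
           ∃[ ts ] C.HaltsWithin (t + suc (⟦ r ⟧ N)) (C.initial (w ∷ x ∷ y ∷ [])) ts × mapᵥ readTape ts ≡ s
    runs {r} {N} (within time≤) (ran refl) =
      let ts , exits , eq = simulates p wf placed-stacks
      in ts
       , subst (λ c → C.HaltsWithin (t + suc (⟦ r ⟧ N)) c ts) (sym initial-placed)
           (runs-M blankTape (inputTape x) (inputTape y) (replicateᵥ k blankTape) halts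
             (HaltsWithin-mono composed time≤ (runs-program exits)))
       , eq

  module Computing (f : Word → Word) (q : Poly)
    (computes : ∀ (w : Word) → ∃[ ts ] TM.HaltsWithin M (⟦ q ⟧ (length w + 0)) (TM.initial M (w ∷ [])) ts
                            × TM.output M ts ≡ f w) where

    sizeBound : Poly
    sizeBound = X ⊕ (con 1 ⊕ q) ⊗ con (2 + #work)

    size-bound : ∀ (w : Word) n {m} → m ≤ length w + n + suc (⟦ q ⟧ (length w + 0)) * (2 + #work) →
                 m ≤ ⟦ sizeBound ⟧ (length w + n)
    size-bound w n h = ≤-trans h (+-monoʳ-≤ (length w + n)
      (*-monoˡ-≤ (2 + #work) (s≤s (⟦⟧-mono q (+-monoʳ-≤ (length w) z≤n)))))

    -- The output is one of the stacks on which the program starts, so the size bound for empty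
    -- certificates applies to it.
    length-f : ∀ w → length (f w) ≤ ⟦ sizeBound ⟧ (length w)
    length-f w =
      let tsₘ , halts , output≡ = computes w
          w′ , ws , size≤ , _ = composed-correct [] [] halts
      in ≤-trans (≤-reflexive (cong length (sym output≡)))
           (≤-trans (length-lookup≤size (start w′ [] [] (TM.output M tsₘ) ws) (suc (suc (suc (suc zero)))))
             (subst (λ k → size (start w′ [] [] (TM.output M tsₘ) ws) ≤ ⟦ sizeBound ⟧ k)
               (+-identityʳ (length w)) (size-bound w 0 size≤)))

    decides : (V : Word → Word → Word → Bool) (r : Poly) →
      (∀ v x {w y ws} → ∃[ s ] Runs p (start w x y v ws) s × lookup s zero ≡ V v x y ∷ []) →
      (∀ v x {w y ws N} → size (start w x y v ws) ≤ N → Within r N p (start w x y v ws)) →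
      PolyTimePredicate₃ (λ w x y → V (f w) x y)
    decides V r p-runs p-time = composed , q ⊕ (con 1 ⊕ r ⟨ sizeBound ⟩) ,
      λ { (w ∷ x ∷ y ∷ []) → correct w x y }
      where
      output-stack : ∀ ts → C.output ts ≡ lookup (mapᵥ readTape ts) zero
      output-stack (_ ∷ _) = refl

      correct : ∀ w x y → ∃[ ts ]
        C.HaltsWithin (⟦ q ⊕ (con 1 ⊕ r ⟨ sizeBound ⟩) ⟧ (totalLength (w ∷ x ∷ y ∷ [])))
                      (C.initial (w ∷ x ∷ y ∷ [])) ts
        × C.output ts ≡ V (f w) x y ∷ []
      correct w x y =
        let n = length w + (length x + (length y + 0))
            tsₘ , halts , output≡ = computes w
            w′ , ws , size≤ , composed-halts = composed-correct x y halts
            s , runs , s≡ = p-runs (TM.output M tsₘ) x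
            size≤N = subst (λ k → size (start w′ x y (TM.output M tsₘ) ws) ≤ ⟦ sizeBound ⟧ k)
              (cong (λ k → length w + (length x + k)) (sym (+-identityʳ (length y))))
              (size-bound w (length x + length y) size≤)
            ts , halts′ , stacks≡ = composed-halts (p-time (TM.output M tsₘ) x size≤N) runs
        in ts
         , HaltsWithin-mono composed
             (+-mono-≤ (⟦⟧-mono q (+-monoʳ-≤ (length w) z≤n))
                       (s≤s (≤-reflexive (sym (⟦⟧-⟨⟩ r sizeBound n)))))
             halts′
         , trans (output-stack ts) (trans (cong (λ s → lookup s zero) stacks≡)
             (trans s≡ (cong (λ v → V v x y ∷ []) output≡)))

-- Reading circuits bit by bit

-- What to do with the wire whose index is being read; `first false` stands for the
-- left argument of a conjunction, `first true` for that of a disjunction.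
data Use : Set where
  first  : Bool → Use
  second : Bool → Bool → Use
  negate : Use
  answer : Use

data Mode : Set where
  fresh    : Mode
  opcode   : Mode
  opcode₁  : Bool → Mode
  constant : Mode
  index    : Use → Mode
  done     : Bool → Mode
  failed   : Mode

connect : Bool → Bool → Bool → Bool
connect false = _∧_
connect true  = _∨_

-- The mode, the wires, and the wires already passed in search of an index (last first).
Reader : Set
Reader = Mode × Word × Word

use : Use → Bool → Word → Reader
use (first o)    a v = index (second o a) , v , []
use (second o c) a v = fresh , connect o c a ∷ v , []
use negate       a v = fresh , not a ∷ v , []
use answer       a v = done a , v , []

-- A finished reader tolerates no further bit, and an index that runs out of wires fails. Hence a
-- fresh reader ends in `done` only if the whole word is the code of one circuit on the given wires.
advance : Reader → Bool → Reader
advance (fresh , v , u) false         = index answer , v , u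
advance (fresh , v , u) true         = opcode , v , u
advance (opcode , v , u) b        = opcode₁ b , v , u
advance (opcode₁ false , v , u) b = index (first b) , v , u
advance (opcode₁ true , v , u) false  = index negate , v , u
advance (opcode₁ true , v , u) true  = constant , v , u
advance (constant , v , u) b      = fresh , b ∷ v , u
advance (index k , [] , u) b      = failed , [] , u
advance (index k , a ∷ v , u) true   = index k , v , a ∷ u
advance (index k , a ∷ v , u) false   = use k a (u ʳ++ (a ∷ v))
advance (done a , v , u) b        = failed , v , u
advance (failed , v , u) b        = failed , v , u

advances : Word → Reader → Reader
advances []      r = r
advances (b ∷ w) r = advances w (advance r b)

evalWord : Word → Word → Mode
evalWord w v = proj₁ (advances w (fresh , v , []))

advances-index : ∀ {n} (i : Fin n) (v : Vec Bool n) k u w →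
  advances (unary (toℕ i) ++ₗ w) (index k , toList v , u) ≡
  advances w (use k (lookup v i) (u ʳ++ toList v))
advances-index zero    (a ∷ v) k u w = refl
advances-index (suc i) (a ∷ v) k u w = advances-index i v k (a ∷ u) w

advances-gate : ∀ {n} (g : Gate n) (v : Vec Bool n) w →
  advances (true ∷ encodeGate g ++ₗ w) (fresh , toList v , []) ≡
  advances w (fresh , evalGate g v ∷ toList v , [])
advances-gate (andG i j) v w
  rewrite ++ₗ-assoc (unary (toℕ i)) (unary (toℕ j)) w
        | advances-index i v (first false) [] (unary (toℕ j) ++ₗ w) =
  advances-index j v (second false (lookup v i)) [] w
advances-gate (orG i j) v w
  rewrite ++ₗ-assoc (unary (toℕ i)) (unary (toℕ j)) w
        | advances-index i v (first true) [] (unary (toℕ j) ++ₗ w) =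
  advances-index j v (second true (lookup v i)) [] w
advances-gate (notG i)   v w = advances-index i v negate [] w
advances-gate (constG b) v w = refl

evalWord-encodeGates : ∀ {n} (C : Circuit n) v →
                       evalWord (encodeGates C) (toList v) ≡ done (eval C v)
evalWord-encodeGates (out i) v = cong proj₁
  (trans (cong (λ w → advances w (index answer , toList v , [])) (sym (++ₗ-identityʳ (unary (toℕ i)))))
         (advances-index i v answer [] []))
evalWord-encodeGates (g ▷ C) v =
  trans (cong proj₁ (advances-gate g v (encodeGates C))) (evalWord-encodeGates C (evalGate g v ∷ v))

advances-failed : ∀ w {v u} → proj₁ (advances w (failed , v , u)) ≡ failed
advances-failed []      = refl
advances-failed (b ∷ w) = advances-failed w

failed≢done : ∀ w {v u a} → proj₁ (advances w (failed , v , u)) ≢ done a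
failed≢done w eq with () ← trans (sym (advances-failed w)) eq

index-sound : ∀ {n} (v : Vec Bool n) {k u a} w →
  proj₁ (advances w (index k , toList v , u)) ≡ done a →
  ∃[ i ] ∃[ w′ ] w ≡ unary (toℕ {n} i) ++ₗ w′
index-sound []      (b ∷ w)     eq = ⊥-elim (failed≢done w eq)
index-sound (c ∷ v) (false ∷ w) eq = zero , w , refl
index-sound (c ∷ v) (true ∷ w)  eq with index-sound v w eq
... | i , w′ , refl = suc i , w′ , refl

done-sound : ∀ w {a v u c} → proj₁ (advances w (done a , v , u)) ≡ done c → w ≡ []
done-sound []      eq = refl
done-sound (b ∷ w) eq = ⊥-elim (failed≢done w eq)

gate-sound : ∀ {n} (v : Vec Bool n) {a} w →
  proj₁ (advances w (opcode , toList v , [])) ≡ done a →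
  ∃[ g ] ∃[ w′ ] w ≡ encodeGate {n} g ++ₗ w′
gate-sound v (true ∷ true ∷ b ∷ w) eq = constG b , w , refl
gate-sound v (true ∷ false ∷ w)    eq with index-sound v w eq
... | i , w′ , refl = notG i , w′ , refl
gate-sound v (false ∷ o ∷ w) eq with index-sound v w eq
... | i , w′ , refl rewrite advances-index i v (first o) [] w′ with index-sound v w′ eq
gate-sound v (false ∷ false ∷ _) eq | i , _ , refl | j , w″ , refl =
  andG i j , w″ , cong (λ w → false ∷ false ∷ w) (sym (++ₗ-assoc (unary (toℕ i)) _ w″))
gate-sound v (false ∷ true ∷ _) eq | i , _ , refl | j , w″ , refl =
  orG i j , w″ , cong (λ w → false ∷ true ∷ w) (sym (++ₗ-assoc (unary (toℕ i)) _ w″))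

-- Whether the reader fails depends on the number of wires and not on their values, so one
-- successful evaluation certifies that the word is a circuit.
evalWord-sound : ∀ {n} (v : Vec Bool n) {a} w → evalWord w (toList v) ≡ done a →
                 ∃[ C ] w ≡ encodeGates {n} C
evalWord-sound v w = bounded v (length w) w ≤-refl
  where
  -- The recursion is on a bound for the length because the rest after a gate is not a structural
  -- part of the word.
  bounded : ∀ {n} (v : Vec Bool n) {a} ℓ w → length w ≤ ℓ →
            evalWord w (toList v) ≡ done a → ∃[ C ] w ≡ encodeGates {n} C
  bounded v ℓ (false ∷ w) len eq with index-sound v w eq
  ... | i , w′ , refl
    with refl ← done-sound w′ (trans (cong proj₁ (sym (advances-index i v answer [] w′))) eq) =
    out i , cong (false ∷_) (++ₗ-identityʳ (unary (toℕ i)))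
  bounded v (suc ℓ) (true ∷ w) (s≤s len) eq with gate-sound v w eq
  ... | g , w′ , refl
    with bounded (evalGate g v ∷ v) ℓ w′
           (≤-trans (≤-trans (m≤n+m _ (length (encodeGate g))) (≤-reflexive (sym (length-++ (encodeGate g))))) len)
           (trans (cong proj₁ (sym (advances-gate g v w′))) eq)
  ... | C , refl = g ▷ C , refl

-- The verifier

module _ {K : ℕ} where

  infixr 5 _⨟_
  infixl 4 _↝_

  _⨟_ : ∀ {p q : Prog K} {s s′ s″} → Runs p s s′ → Runs q s′ s″ → Runs (p ⨾ q) s s″
  ran refl ⨟ ran eq = ran eq

  _↝_ : ∀ {p : Prog K} {s s′ s″} → Runs p s s′ → s′ ≡ s″ → Runs p s s″
  ran eq ↝ eq′ = ran (trans eq eq′)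

  loopBound : (Bool → Prog K) → Poly
  loopBound p = con 1 ⊕ X ⊗ (con 1 ⊕ (timeBound (p false) ⊕ timeBound (p true)))

  -- For a loop whose body has a factor above 1, as copying a stack causes, the affine bounds are
  -- useless. Here an invariant keeps the size at most N before each run of the body, so the body is
  -- charged at N itself.
  loop-time : ∀ {i p N} (Inv : Word → Stacks K → Set) →
    (∀ b → WellFormed (p b)) → (∀ b → Tame (p b)) →
    (∀ b u s → Inv (b ∷ u) s → size (s [ i ]≔ u) ≤ N × ∃[ s′ ] Runs (p b) (s [ i ]≔ u) s′ × Inv u s′) →
    ∀ {s} → size s ≤ N → Inv (lookup s i) s → Within (loopBound p) N (loop i p) s
  loop-time {i} {p} {N} Inv wf tm step {s} size≤N inv = within (≤-trans
    (iterate-time Inv step′ (lookup s i) s inv)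
    (s≤s (*-monoˡ-≤ (suc (⟦ timeBound (p false) ⊕ timeBound (p true) ⟧ N)) (≤-trans (length-lookup≤size s i) size≤N))))
    where
    step′ : ∀ b u s → Inv (b ∷ u) s →
            time (p b) (s [ i ]≔ u) ≤ ⟦ timeBound (p false) ⊕ timeBound (p true) ⟧ N
          × Inv u (run (p b) (s [ i ]≔ u))
    step′ b u s inv with step b u s inv
    ... | size≤ , _ , ran refl , inv′ =
      ≤-trans (run-time (p b) (wf b) (tm b) _ size≤) (≤-sum (λ b → ⟦ timeBound (p b) ⟧ N) b) , inv′

  sequel-bound : ∀ {p q : Prog K} {s s′ N} (r : Poly) → Runs p s s′ → WellFormed p → Tame p → size s ≤ N →
    (∀ {N} → size s′ ≤ N → Within r N q s′) →
    Within (timeBound p ⊕ r ⟨ con (factor p) ⊗ X ⊕ con (offset p) ⟩) N (p ⨾ q) s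
  sequel-bound {p} {s = s} {N = N} r (ran refl) wf tm size≤N q-within = within (+-mono-≤
    (run-time p wf tm s size≤N)
    (≤-trans (bound (q-within (≤-trans (run-size p wf tm s) (+-monoˡ-≤ (offset p) (*-monoʳ-≤ (factor p) size≤N)))))
             (≤-reflexive (sym (⟦⟧-⟨⟩ r (con (factor p) ⊗ X ⊕ con (offset p)) N)))))

  pop-[] : ∀ {i} {p : Prog K} {q s s′} → lookup s i ≡ [] → Runs p s s′ → Runs (pop i p q) s s′
  pop-[] {i} {p} {q} {s} eq (ran refl) =
    ran (cong (caseWord (run p s) (λ b u → run (q b) (s [ i ]≔ u))) eq)

  loop-∷ : ∀ {i} {p : Bool → Prog K} {b u s s′ s″} → lookup s i ≡ b ∷ u → Runs (p b) (s [ i ]≔ u) s′ →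
           lookup s′ i ≡ u → Runs (loop i p) s′ s″ → Runs (loop i p) s s″
  loop-∷ {i} {p} {b} {u} {s} {s′} eq (ran eq₁) eq₂ (ran eq₃) = ran
    (trans (cong (λ w → iterate (λ b → run (p b)) i w s) eq)
    (trans (cong (iterate (λ b → run (p b)) i u) eq₁)
    (trans (cong (λ w → iterate (λ b → run (p b)) i w s′) (sym eq₂)) eq₃)))

  clear : Fin K → Prog K
  clear i = loop i λ _ → skip

  drain : Fin K → Fin K → Prog K
  drain i j = loop i (push j)

  drainTwice : Fin K → Fin K → Fin K → Prog K
  drainTwice i j k = loop i λ b → push j b ⨾ push k b

  -- Pushes the reversal of stack i onto stack j and keeps stack i; stack k must be empty.
  load : Fin K → Fin K → Fin K → Prog K
  load i j k = drainTwice i j k ⨾ drain k i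

  update-same : ∀ {s : Stacks K} {i w} → lookup s i ≡ w → s [ i ]≔ w ≡ s
  update-same {s} {i} refl = []≔-lookup s i

  clear-runs : ∀ i (s : Stacks K) → Runs (clear i) s (s [ i ]≔ [])
  clear-runs i s = ran (go (lookup s i) s refl)
    where
    go : ∀ u s → lookup s i ≡ u → iterate (λ _ s → s) i u s ≡ s [ i ]≔ []
    go []      s eq = sym (update-same eq)
    go (b ∷ u) s eq = trans (go u (s [ i ]≔ u) (lookup∘update i s u)) ([]≔-idempotent s i)

  module _ {i j : Fin K} (i≢j : i ≢ j) where

    update₂-update : ∀ (s : Stacks K) {x y z} → ((s [ i ]≔ x) [ j ]≔ y) [ i ]≔ z ≡ (s [ i ]≔ z) [ j ]≔ y
    update₂-update s = trans ([]≔-commutes _ j i (i≢j ∘ sym)) (cong (_[ j ]≔ _) ([]≔-idempotent s i))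

    drain-runs : ∀ s → Runs (drain i j) s ((s [ i ]≔ []) [ j ]≔ (lookup s i ʳ++ lookup s j))
    drain-runs s = ran (go (lookup s i) s refl)
      where
      go : ∀ u s → lookup s i ≡ u →
           iterate (λ b → run (push j b)) i u s ≡ (s [ i ]≔ []) [ j ]≔ (u ʳ++ lookup s j)
      go []      s eq = sym (trans (cong (_[ j ]≔ lookup s j) (update-same eq)) ([]≔-lookup s j))
      go (b ∷ u) s eq = begin
        iterate (λ b → run (push j b)) i u s′
          ≡⟨ go u s′ (trans (lookup∘update′ i≢j (s [ i ]≔ u) _) (lookup∘update i s u)) ⟩
        (s′ [ i ]≔ []) [ j ]≔ (u ʳ++ lookup s′ j)
          ≡⟨ cong₂ (λ s w → s [ j ]≔ (u ʳ++ w)) (update₂-update s) (lookup∘update j (s [ i ]≔ u) _) ⟩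
        ((s [ i ]≔ []) [ j ]≔ (b ∷ lookup (s [ i ]≔ u) j)) [ j ]≔ (u ʳ++ (b ∷ lookup (s [ i ]≔ u) j))
          ≡⟨ []≔-idempotent (s [ i ]≔ []) j ⟩
        (s [ i ]≔ []) [ j ]≔ (u ʳ++ (b ∷ lookup (s [ i ]≔ u) j))
          ≡⟨ cong (λ w → (s [ i ]≔ []) [ j ]≔ (u ʳ++ (b ∷ w))) (lookup∘update′ (i≢j ∘ sym) s u) ⟩
        (s [ i ]≔ []) [ j ]≔ (u ʳ++ (b ∷ lookup s j)) ∎
        where
        open ≡-Reasoning
        s′ = (s [ i ]≔ u) [ j ]≔ (b ∷ lookup (s [ i ]≔ u) j)

ones-ʳ++ : ∀ m n → replicate m true ʳ++ replicate n true ≡ replicate (m + n) true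
ones-ʳ++ zero    n = refl
ones-ʳ++ (suc m) n = trans (ones-ʳ++ m (suc n)) (cong (λ k → replicate k true) (+-suc m n))

-- Prefix-free, so that `dispatch` below can decode it from the top of a stack.
encodeMode : Mode → Word
encodeMode fresh                = false ∷ false ∷ false ∷ []
encodeMode opcode               = false ∷ false ∷ true ∷ []
encodeMode constant             = false ∷ true ∷ false ∷ []
encodeMode failed               = false ∷ true ∷ true ∷ []
encodeMode (opcode₁ b)          = true ∷ false ∷ false ∷ b ∷ []
encodeMode (done a)             = true ∷ false ∷ true ∷ a ∷ []
encodeMode (index negate)       = true ∷ true ∷ false ∷ false ∷ []
encodeMode (index answer)       = true ∷ true ∷ false ∷ true ∷ []
encodeMode (index (first o))    = true ∷ true ∷ true ∷ false ∷ o ∷ []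
encodeMode (index (second o a)) = true ∷ true ∷ true ∷ true ∷ o ∷ a ∷ []

-- The verdict on a pair of vertices

valid : Mode → Bool
valid (done _) = true
valid _        = false

-- Words serve as flags, which are raised when nonempty.
unexpected : Bool → Mode → Word → Word
unexpected e     (done a) d = if a then (if e then d else true ∷ d) else (if e then true ∷ d else d)
unexpected e     _        d = d

mismatch : Word → Word → Word → Word
mismatch []      b       e = e
mismatch (x ∷ a) []      e = mismatch a [] e
mismatch (x ∷ a) (y ∷ b) e =
  mismatch a b (if x then (if y then e else true ∷ e) else (if y then true ∷ e else e))

-- Both flags are required: failing to beat a vertex counts only if that vertex is a different one.
reject : Word → Word → Bool → Bool
reject []      e       o = o
reject (_ ∷ _) []      o = o
reject (_ ∷ _) (_ ∷ _) o = false

-- Describes stack B after the comparison, so that the run can be stated exactly; the stack is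
-- cleared afterwards.
leftover : Word → Word → Word
leftover []      b       = b
leftover (x ∷ a) []      = leftover a []
leftover (x ∷ a) (y ∷ b) = leftover a b

-- a and b are the reversals of the two vertices
judge : Word → Word → Word → Bool → Bool
judge u a b o = reject (unexpected false m₂ (unexpected true m₁ [])) (mismatch a b [])
                       (if valid m₂ then (if valid m₁ then o else false) else false)
  where
  m₁ = evalWord u (a ʳ++ (b ʳ++ []))
  m₂ = evalWord u (b ʳ++ (a ʳ++ []))

-- k bits of the current block are still to be read, j have been read. A block has one
-- bit more than a vertex; the additional bit, of any value, triggers the judgement.
judgeBlocks : Word → Word → (k j : ℕ) → Word → Bool → Word → Bool
judgeBlocks u a k       j b o []      = o
judgeBlocks u a zero    j b o (_ ∷ y) = judgeBlocks u a j 0 [] (judge u a b o) y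
judgeBlocks u a (suc k) j b o (c ∷ y) = judgeBlocks u a k (suc j) (c ∷ b) o y

header : ℕ → Word → ℕ
header n []          = n
header n (true  ∷ w) = header (suc n) w
header n (false ∷ w) = n

terminated : Word → Bool
terminated []          = false
terminated (true  ∷ w) = terminated w
terminated (false ∷ w) = true

body : Word → Word
body []          = []
body (true  ∷ w) = body w
body (false ∷ w) = w

-- An arbitrary certificate has to stand for some vertex: zeros fill up a short word, and bits
-- beyond the n-th are not read. The result is reversed because it is popped off one stack and
-- pushed onto another.
pad : ℕ → Word → Word → Word
pad zero    x       a = a
pad (suc n) []      a = pad n [] (false ∷ a)
pad (suc n) (b ∷ x) a = pad n x (b ∷ a)

unread : ℕ → Word → Word
unread zero    x       = x
unread (suc n) []      = unread n []
unread (suc n) (b ∷ x) = unread n x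

-- Starting from `terminated f` lets a word without a complete header lose against every challenge,
-- even the empty one.
verdict : Word → Word → Word → Bool
verdict f x y = judgeBlocks (body f) (pad n x []) n 0 [] (terminated f) y
  where n = header 0 f

-- The verifier as a stack program, and the runs of its parts

module Verifier (mw : ℕ) where

  K : ℕ
  K = 16 + mw

  Oᵢ Wᵢ Xᵢ Yᵢ Fᵢ Gᵢ Nᵢ Cᵢ Aᵢ Bᵢ Tᵢ Vᵢ Uᵢ Rᵢ Dᵢ Eᵢ : Fin K
  Oᵢ = 0F
  Wᵢ = 1F
  Xᵢ = 2F
  Yᵢ = 3F
  Fᵢ = 4F
  Gᵢ = 5F
  Nᵢ = 6F
  Cᵢ = 7F
  Aᵢ = 8F
  Bᵢ = 9F
  Tᵢ = suc 9F
  Vᵢ = suc (suc 9F)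
  Uᵢ = suc (suc (suc 9F))
  Rᵢ = suc (suc (suc (suc 9F)))
  Dᵢ = suc (suc (suc (suc (suc 9F))))
  Eᵢ = suc (suc (suc (suc (suc (suc 9F)))))

  -- O: the verdict, one bit. W: used up by the reduction. X, Y: the certificates.
  -- F, G: the code of the circuit and its reversal. N, C: the unary numbers k and j of
  -- `judgeBlocks`. A, B: the reversals of the two vertices. T: auxiliary. V, U, R: the
  -- wires, the passed wires and the mode of a reader. D: raised if the values of the
  -- circuit do not show that the first vertex beats the second. E: raised if they differ.
  st : (o w x y f g n c a b t v u r d e : Word) → Vec Word mw → Stacks K
  st o w x y f g n c a b t v u r d e ws =
    o ∷ w ∷ x ∷ y ∷ f ∷ g ∷ n ∷ c ∷ a ∷ b ∷ t ∷ v ∷ u ∷ r ∷ d ∷ e ∷ ws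

  failure : Prog K
  failure = pop Oᵢ skip λ _ → push Oᵢ false

  setWord : Word → Prog K
  setWord []      = skip
  setWord (b ∷ w) = setWord w ⨾ push Rᵢ b

  setMode : Mode → Prog K
  setMode m = setWord (encodeMode m)

  read : (Bool → Prog K) → Prog K
  read = pop Rᵢ skip

  either : Prog K → Prog K → Bool → Prog K
  either p q false = p
  either p q true  = q

  dispatch : (Mode → Prog K) → Prog K
  dispatch k = read (either
    (read (either
      (read (either (k fresh) (k opcode)))
      (read (either (k constant) (k failed)))))
    (read (either
      (read (either (read λ b → k (opcode₁ b)) (read λ a → k (done a))))
      (read (either
        (read (either (k (index negate)) (k (index answer))))
        (read (either (read λ o → k (index (first o)))
                      (read λ o → read λ a → k (index (second o a))))))))))

  useWire : Use → Bool → Prog K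
  useWire (first o)    a = setMode (index (second o a))
  useWire (second o c) a = push Vᵢ (connect o c a) ⨾ setMode fresh
  useWire negate       a = push Vᵢ (not a) ⨾ setMode fresh
  useWire answer       a = setMode (done a)

  react : Bool → Mode → Prog K
  react false fresh           = setMode (index answer)
  react true  fresh           = setMode opcode
  react b     opcode          = setMode (opcode₁ b)
  react b     (opcode₁ false) = setMode (index (first b))
  react false (opcode₁ true)  = setMode (index negate)
  react true  (opcode₁ true)  = setMode constant
  react b     constant        = push Vᵢ b ⨾ setMode fresh
  react true  (index k)       =
    pop Vᵢ (setMode failed) λ a → push Uᵢ a ⨾ setMode (index k)
  react false (index k)       =
    pop Vᵢ (setMode failed) λ a → push Vᵢ a ⨾ drain Uᵢ Vᵢ ⨾ useWire k a
  react b     (done a)        = setMode failed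
  react b     failed          = setMode failed

  readGates : Prog K
  readGates = loop Fᵢ λ b → push Gᵢ b ⨾ dispatch (react b)

  evaluate : Prog K
  evaluate = drain Gᵢ Fᵢ ⨾ setMode fresh ⨾ readGates ⨾ clear Vᵢ ⨾ clear Uᵢ

  expect : Bool → Prog K
  expect e = dispatch λ
    { (done a) → if a then (if e then skip else push Dᵢ true) else (if e then push Dᵢ true else skip)
    ; _        → failure }

  compareVertices : Prog K
  compareVertices = loop Aᵢ λ x → push Tᵢ x ⨾ pop Bᵢ skip λ y →
    if x then (if y then skip else push Eᵢ true) else (if y then push Eᵢ true else skip)

  settle : Prog K
  settle = (pop Dᵢ skip λ _ → pop Eᵢ skip λ _ → failure) ⨾ clear Dᵢ ⨾ clear Eᵢ

  judgeBlock : Prog K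
  judgeBlock =
    load Bᵢ Vᵢ Tᵢ ⨾ load Aᵢ Vᵢ Tᵢ ⨾ evaluate ⨾ expect true ⨾
    load Aᵢ Vᵢ Tᵢ ⨾ load Bᵢ Vᵢ Tᵢ ⨾ evaluate ⨾ expect false ⨾
    compareVertices ⨾ drain Tᵢ Aᵢ ⨾ clear Bᵢ ⨾ settle

  readChallenge : Bool → Prog K
  readChallenge b = pop Nᵢ (judgeBlock ⨾ drain Cᵢ Nᵢ) λ _ → push Cᵢ true ⨾ push Bᵢ b

  -- A loop cannot be left early, so one loop does both jobs: stack R is raised at the end of the
  -- unary header, and from then on the bits go to G instead of being counted.
  readHeader : Prog K
  readHeader = loop Fᵢ λ b →
    pop Rᵢ (if b then push Nᵢ true else push Rᵢ true) λ _ → push Gᵢ b ⨾ push Rᵢ true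

  readVertex : Prog K
  readVertex = loop Nᵢ λ _ → push Cᵢ true ⨾ pop Xᵢ (push Aᵢ false) (push Aᵢ)

  setup : Prog K
  setup = push Oᵢ true ⨾ readHeader ⨾ pop Rᵢ failure (λ _ → skip) ⨾
          readVertex ⨾ drain Cᵢ Nᵢ

  verifier : Prog K
  verifier = setup ⨾ loop Yᵢ readChallenge

  verifier-wellFormed : WellFormed verifier
  verifier-wellFormed = toWitness {a? = wellFormed? verifier} _

  setup-tame : Tame setup
  setup-tame = toWitness {a? = tame? setup} _

  readChallenge-wellFormed : ∀ b → WellFormed (readChallenge b)
  readChallenge-wellFormed b = toWitness {a? = wellFormed? (readChallenge b)} _

  readChallenge-tame : ∀ b → Tame (readChallenge b)
  readChallenge-tame b = toWitness {a? = tame? (readChallenge b)} _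

  dispatch-runs : ∀ k m {o w x y f g n c a b t v u d e ws s} →
    Runs (k m) (st o w x y f g n c a b t v u [] d e ws) s →
    Runs (dispatch k) (st o w x y f g n c a b t v u (encodeMode m) d e ws) s
  dispatch-runs k fresh                       (ran eq) = ran eq
  dispatch-runs k opcode                      (ran eq) = ran eq
  dispatch-runs k constant                    (ran eq) = ran eq
  dispatch-runs k failed                      (ran eq) = ran eq
  dispatch-runs k (opcode₁ false)             (ran eq) = ran eq
  dispatch-runs k (opcode₁ true)              (ran eq) = ran eq
  dispatch-runs k (done false)                (ran eq) = ran eq
  dispatch-runs k (done true)                 (ran eq) = ran eq
  dispatch-runs k (index negate)              (ran eq) = ran eq
  dispatch-runs k (index answer)              (ran eq) = ran eq
  dispatch-runs k (index (first false))       (ran eq) = ran eq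
  dispatch-runs k (index (first true))        (ran eq) = ran eq
  dispatch-runs k (index (second false false)) (ran eq) = ran eq
  dispatch-runs k (index (second false true)) (ran eq) = ran eq
  dispatch-runs k (index (second true false)) (ran eq) = ran eq
  dispatch-runs k (index (second true true))  (ran eq) = ran eq

  module _ {o w x y n c a b t d e : Word} {ws : Vec Word mw} where

    reading : (f g : Word) → Reader → Stacks K
    reading f g (m , v , u) = st o w x y f g n c a b t v u (encodeMode m) d e ws

    setMode-runs : ∀ m {f g v u} →
      Runs (setMode m) (st o w x y f g n c a b t v u [] d e ws) (reading f g (m , v , u))
    setMode-runs fresh                = ran refl
    setMode-runs opcode               = ran refl
    setMode-runs constant             = ran refl
    setMode-runs failed               = ran refl
    setMode-runs (opcode₁ _)          = ran refl
    setMode-runs (done _)             = ran refl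
    setMode-runs (index negate)       = ran refl
    setMode-runs (index answer)       = ran refl
    setMode-runs (index (first _))    = ran refl
    setMode-runs (index (second _ _)) = ran refl

    useWire-runs : ∀ k z {f g v} →
      Runs (useWire k z) (st o w x y f g n c a b t v [] [] d e ws) (reading f g (use k z v))
    useWire-runs (first _)    z = ran refl
    useWire-runs (second _ _) z = ran refl
    useWire-runs negate       z = ran refl
    useWire-runs answer       z = ran refl

    react-runs : ∀ (z : Bool) (r : Reader) {f g} →
      Runs (react z (proj₁ r)) (st o w x y f g n c a b t (proj₁ (proj₂ r)) (proj₂ (proj₂ r)) [] d e ws)
           (reading f g (advance r z))
    react-runs false (fresh , v , u)         = ran refl
    react-runs true  (fresh , v , u)         = ran refl
    react-runs false (opcode , v , u)        = ran refl
    react-runs true  (opcode , v , u)        = ran refl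
    react-runs false (opcode₁ false , v , u) = ran refl
    react-runs true  (opcode₁ false , v , u) = ran refl
    react-runs false (opcode₁ true , v , u)  = ran refl
    react-runs true  (opcode₁ true , v , u)  = ran refl
    react-runs false (constant , v , u)      = ran refl
    react-runs true  (constant , v , u)      = ran refl
    react-runs false (index k , [] , u)      = ran refl
    react-runs true  (index k , [] , u)      = ran refl
    react-runs true  (index k , z ∷ v , u)   = ran (result (setMode-runs (index k)))
    react-runs false (index k , z ∷ v , u) {f} {g} =
      ran (result (drain-runs {i = Uᵢ} {Vᵢ} (λ ()) (st o w x y f g n c a b t (z ∷ v) u [] d e ws) ⨟ useWire-runs k z))
    react-runs false (done _ , v , u)        = ran refl
    react-runs true  (done _ , v , u)        = ran refl
    react-runs false (failed , v , u)        = ran refl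
    react-runs true  (failed , v , u)        = ran refl

    readGates-runs : ∀ f {g} r → Runs readGates (reading f g r) (reading [] (f ʳ++ g) (advances f r))
    readGates-runs []      r = ran refl
    readGates-runs (z ∷ f) r@(m , v , u) =
      loop-∷ refl (ran refl ⨟ dispatch-runs (react z) m (react-runs z r)) refl
        (readGates-runs f (advance r z))

    evaluate-runs : ∀ {g v} →
      Runs evaluate (st o w x y [] g n c a b t v [] [] d e ws)
        (st o w x y [] g n c a b t [] [] (encodeMode (evalWord (g ʳ++ []) v)) d e ws)
    evaluate-runs {g} {v} =
      drain-runs (λ ()) _
      ⨟ setMode-runs fresh
      ⨟ readGates-runs (g ʳ++ []) (fresh , v , [])
      ⨟ clear-runs Vᵢ _
      ⨟ clear-runs Uᵢ _
      ↝ cong (λ g′ → st o w x y [] g′ n c a b t [] [] (encodeMode (evalWord (g ʳ++ []) v)) d e ws)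
             (reverse-involutive g)

  expect-runs : ∀ z m {o w x y g n c a b t d e ws} →
    Runs (expect z) (st (o ∷ []) w x y [] g n c a b t [] [] (encodeMode m) d e ws)
      (st ((if valid m then o else false) ∷ []) w x y [] g n c a b t [] [] [] (unexpected z m d) e ws)
  expect-runs z     fresh                       = ran refl
  expect-runs z     opcode                      = ran refl
  expect-runs z     constant                    = ran refl
  expect-runs z     failed                      = ran refl
  expect-runs z     (opcode₁ false)             = ran refl
  expect-runs z     (opcode₁ true)              = ran refl
  expect-runs false (done false)                = ran refl
  expect-runs false (done true)                 = ran refl
  expect-runs true  (done false)                = ran refl
  expect-runs true  (done true)                 = ran refl
  expect-runs z     (index negate)              = ran refl
  expect-runs z     (index answer)              = ran refl
  expect-runs z     (index (first false))       = ran refl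
  expect-runs z     (index (first true))        = ran refl
  expect-runs z     (index (second false false)) = ran refl
  expect-runs z     (index (second false true)) = ran refl
  expect-runs z     (index (second true false)) = ran refl
  expect-runs z     (index (second true true))  = ran refl

  copyA-runs : ∀ a {o w x y f g n c b t v u r d e ws} →
    Runs (drainTwice Aᵢ Vᵢ Tᵢ) (st o w x y f g n c a b t v u r d e ws)
      (st o w x y f g n c [] b (a ʳ++ t) (a ʳ++ v) u r d e ws)
  copyA-runs []      = ran refl
  copyA-runs (z ∷ a) {t = t} {v} = ran (result (copyA-runs a {t = z ∷ t} {z ∷ v}))

  copyB-runs : ∀ b {o w x y f g n c a t v u r d e ws} →
    Runs (drainTwice Bᵢ Vᵢ Tᵢ) (st o w x y f g n c a b t v u r d e ws)
      (st o w x y f g n c a [] (b ʳ++ t) (b ʳ++ v) u r d e ws)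
  copyB-runs []      = ran refl
  copyB-runs (z ∷ b) {t = t} {v} = ran (result (copyB-runs b {t = z ∷ t} {z ∷ v}))

  loadA-runs : ∀ {o w x y f g n c a b v u r d e ws} →
    Runs (load Aᵢ Vᵢ Tᵢ) (st o w x y f g n c a b [] v u r d e ws)
      (st o w x y f g n c a b [] (a ʳ++ v) u r d e ws)
  loadA-runs {o} {w} {x} {y} {f} {g} {n} {c} {a} {b} {v} {u} {r} {d} {e} {ws} =
    copyA-runs a ⨟ drain-runs (λ ()) _
    ↝ cong (λ a′ → st o w x y f g n c a′ b [] (a ʳ++ v) u r d e ws) (reverse-involutive a)

  loadB-runs : ∀ {o w x y f g n c a b v u r d e ws} →
    Runs (load Bᵢ Vᵢ Tᵢ) (st o w x y f g n c a b [] v u r d e ws)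
      (st o w x y f g n c a b [] (b ʳ++ v) u r d e ws)
  loadB-runs {o} {w} {x} {y} {f} {g} {n} {c} {a} {b} {v} {u} {r} {d} {e} {ws} =
    copyB-runs b ⨟ drain-runs (λ ()) _
    ↝ cong (λ b′ → st o w x y f g n c a b′ [] (b ʳ++ v) u r d e ws) (reverse-involutive b)

  compareVertices-runs : ∀ a b {o w x y f g n c t v u r d e ws} →
    Runs compareVertices (st o w x y f g n c a b t v u r d e ws)
      (st o w x y f g n c [] (leftover a b) (a ʳ++ t) v u r d (mismatch a b e) ws)
  compareVertices-runs []          b           = ran refl
  compareVertices-runs (z ∷ a)     []          = ran (result (compareVertices-runs a []))
  compareVertices-runs (false ∷ a) (false ∷ b) = ran (result (compareVertices-runs a b))
  compareVertices-runs (false ∷ a) (true ∷ b)  = ran (result (compareVertices-runs a b))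
  compareVertices-runs (true ∷ a)  (false ∷ b) = ran (result (compareVertices-runs a b))
  compareVertices-runs (true ∷ a)  (true ∷ b)  = ran (result (compareVertices-runs a b))

  settle-runs : ∀ d e {o w x y f g n c a b t v u r ws} →
    Runs settle (st (o ∷ []) w x y f g n c a b t v u r d e ws)
      (st (reject d e o ∷ []) w x y f g n c a b t v u r [] [] ws)
  settle-runs []      e       = ran refl ⨟ clear-runs Dᵢ _ ⨟ clear-runs Eᵢ _
  settle-runs (_ ∷ d) []      = ran refl ⨟ clear-runs Dᵢ _ ⨟ clear-runs Eᵢ _
  settle-runs (_ ∷ d) (_ ∷ e) = ran refl ⨟ clear-runs Dᵢ _ ⨟ clear-runs Eᵢ _

  module _ {w x g a : Word} {ws : Vec Word mw} where

    -- the state between two bits of the challenge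
    ready : (k j : ℕ) → Word → Bool → Word → Stacks K
    ready k j b o y =
      st (o ∷ []) w x y [] g (replicate k true) (replicate j true) a b [] [] [] [] [] [] ws

    judgeBlock-runs : ∀ {k j b o y} →
      Runs judgeBlock (ready k j b o y) (ready k j [] (judge (g ʳ++ []) a b o) y)
    judgeBlock-runs {k} {j} {b} {o} {y} =
      loadB-runs ⨟ loadA-runs ⨟ evaluate-runs ⨟ expect-runs true (evalWord (g ʳ++ []) (a ʳ++ (b ʳ++ [])))
      ⨟ loadA-runs ⨟ loadB-runs ⨟ evaluate-runs ⨟ expect-runs false (evalWord (g ʳ++ []) (b ʳ++ (a ʳ++ [])))
      ⨟ compareVertices-runs a b ⨟ drain-runs (λ ()) _ ⨟ clear-runs Bᵢ _ ⨟ settle-runs _ _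
      ↝ cong (λ a′ → st (judge (g ʳ++ []) a b o ∷ []) w x y [] g (replicate k true) (replicate j true)
                        a′ [] [] [] [] [] [] [] ws)
             (reverse-involutive a)

    readChallenge-full : ∀ z {j b o y} →
      Runs (readChallenge z) (ready 0 j b o y) (ready j 0 [] (judge (g ʳ++ []) a b o) y)
    readChallenge-full z {j} {b} {o} {y} = pop-[] refl (judgeBlock-runs {0} {j} ⨟ drain-runs (λ ()) _
      ↝ cong (λ n → st (judge (g ʳ++ []) a b o ∷ []) w x y [] g n [] a [] [] [] [] [] [] [] ws)
             (trans (ones-ʳ++ j 0) (cong (λ k → replicate k true) (+-identityʳ j))))

    readChallenge-bit : ∀ z {k j b o y} →
      Runs (readChallenge z) (ready (suc k) j b o y) (ready k (suc j) (z ∷ b) o y)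
    readChallenge-bit z = ran refl

    readChallenges-runs : ∀ y {k j b o} → ∃[ k′ ] ∃[ j′ ] ∃[ b′ ]
      Runs (loop Yᵢ readChallenge) (ready k j b o y)
           (ready k′ j′ b′ (judgeBlocks (g ʳ++ []) a k j b o y) [])
    readChallenges-runs []                      = _ , _ , _ , ran refl
    readChallenges-runs (z ∷ y) {zero}  {j} {b} {o} =
      let k′ , j′ , b′ , runs = readChallenges-runs y {j} {0} {[]} {judge (g ʳ++ []) a b o}
      in k′ , j′ , b′ , loop-∷ refl (readChallenge-full z) refl runs
    readChallenges-runs (z ∷ y) {suc k} {j} {b} {o} =
      let k′ , j′ , b′ , runs = readChallenges-runs y {k} {suc j} {z ∷ b} {o}
      in k′ , j′ , b′ , loop-∷ refl (readChallenge-bit z {k}) refl runs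

  scanBody-runs : ∀ f {o w x y g n c a b t v u d e ws} →
    Runs readHeader (st o w x y f g n c a b t v u (true ∷ []) d e ws)
      (st o w x y [] (f ʳ++ g) n c a b t v u (true ∷ []) d e ws)
  scanBody-runs []      = ran refl
  scanBody-runs (z ∷ f) {g = g} = ran (result (scanBody-runs f {g = z ∷ g}))

  readHeader-runs : ∀ f m {o w x y c a b t v u d e ws} →
    Runs readHeader (st o w x y f [] (replicate m true) c a b t v u [] d e ws)
      (st o w x y [] (body f ʳ++ []) (replicate (header m f) true) c a b t v u
          (if terminated f then true ∷ [] else []) d e ws)
  readHeader-runs []          m = ran refl
  readHeader-runs (true ∷ f)  m = ran (result (readHeader-runs f (suc m)))
  readHeader-runs (false ∷ f) m = ran (result (scanBody-runs f {g = []} {replicate m true}))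

  terminated-runs : ∀ z {w x y f g n c a b t v u d e ws} →
    Runs (pop Rᵢ failure (λ _ → skip))
      (st (true ∷ []) w x y f g n c a b t v u (if z then true ∷ [] else []) d e ws)
      (st (z ∷ []) w x y f g n c a b t v u [] d e ws)
  terminated-runs false = ran refl
  terminated-runs true  = ran refl

  readVertex-runs : ∀ n x {o w y f g c a b t v u r d e ws} →
    Runs readVertex (st o w x y f g (replicate n true) c a b t v u r d e ws)
      (st o w (unread n x) y f g [] (replicate n true ʳ++ c) (pad n x a) b t v u r d e ws)
  readVertex-runs zero    x       = ran refl
  readVertex-runs (suc n) []      {c = c} {a} = ran (result (readVertex-runs n [] {c = true ∷ c} {false ∷ a}))
  readVertex-runs (suc n) (z ∷ x) {c = c} {a} = ran (result (readVertex-runs n x {c = true ∷ c} {z ∷ a}))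

  setup-runs : ∀ f x {w y ws} → let n = header 0 f in
    Runs setup (st [] w x y f [] [] [] [] [] [] [] [] [] [] [] ws)
      (ready {w} {unread n x} {body f ʳ++ []} {pad n x []} {ws} n 0 [] (terminated f) y)
  setup-runs f x {w} {y} {ws} =
    ran refl ⨟ readHeader-runs f 0 ⨟ terminated-runs (terminated f)
    ⨟ readVertex-runs (header 0 f) x ⨟ drain-runs (λ ()) _
    ↝ cong (λ n → st (terminated f ∷ []) w (unread (header 0 f) x) y [] (body f ʳ++ []) n []
                     (pad (header 0 f) x []) [] [] [] [] [] [] [] ws)
           (reverse-involutive (replicate (header 0 f) true))

  verifier-runs : ∀ f x {w y ws} → ∃[ s ]
    Runs verifier (st [] w x y f [] [] [] [] [] [] [] [] [] [] [] ws) s × lookup s Oᵢ ≡ verdict f x y ∷ []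
  verifier-runs f x {y = y} =
    let k , j , b , runs = readChallenges-runs y
    in _ , (setup-runs f x ⨟ runs)
         , cong (λ u → judgeBlocks u (pad (header 0 f) x []) (header 0 f) 0 [] (terminated f) y ∷ [])
                (reverse-involutive (body f))

  -- Running time of the verifier

  module _ {w x g a : Word} {ws : Vec Word mw} where

    ready-size : ∀ k j b o y → size (ready {w} {x} {g} {a} {ws} k j b o y) ≡
      suc (length w + length x + length g + length a + size ws) + (length y + (k + (j + length b)))
    ready-size k j b o y = begin
      size (ready {w} {x} {g} {a} {ws} k j b o y)
        ≡⟨ cong₂ (λ k j → 1 + (lw + (lx + (length y + (lg + (k + (j + (la + (length b + size ws)))))))))
                 (length-replicate k) (length-replicate j) ⟩
      1 + (lw + (lx + (length y + (lg + (k + (j + (la + (length b + size ws))))))))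
        ≡⟨ solve 9 (λ w x y g k j a b s →
             con 1 :+ (w :+ (x :+ (y :+ (g :+ (k :+ (j :+ (a :+ (b :+ s)))))))) :=
             con 1 :+ (w :+ x :+ g :+ a :+ s) :+ (y :+ (k :+ (j :+ b))))
             refl lw lx (length y) lg k j la (length b) (size ws) ⟩
      suc (lw + lx + lg + la + size ws) + (length y + (k + (j + length b))) ∎
      where
      open ≡-Reasoning
      open +-*-Solver using (solve; _:+_; _:=_; con)
      lw = length w
      lx = length x
      lg = length g
      la = length a

    smaller : ∀ {k j b o y k′ j′ b′ o′ y′ N} →
      length y + (k + (j + length b)) ≤ length y′ + (k′ + (j′ + length b′)) →
      size (ready {w} {x} {g} {a} {ws} k′ j′ b′ o′ y′) ≤ N → size (ready {w} {x} {g} {a} {ws} k j b o y) ≤ N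
    smaller {k} {j} {b} {o} {y} {k′} {j′} {b′} {o′} {y′} le h =
      ≤-trans (≤-reflexive (ready-size k j b o y))
        (≤-trans (+-monoʳ-≤ (suc (length w + length x + length g + length a + size ws)) le)
          (≤-trans (≤-reflexive (sym (ready-size k′ j′ b′ o′ y′))) h))

    Ready : ℕ → Word → Stacks K → Set
    Ready N y s = ∃[ k ] ∃[ j ] ∃[ b ] ∃[ o ] s ≡ ready {w} {x} {g} {a} {ws} k j b o y × size s ≤ N

    -- The varying part of the size never grows: reading a bit moves it from Y to B and a mark from
    -- N to C, while a judgement uses up a bit of Y, empties B and returns the marks to N.
    ready-step : ∀ {N} z y s → Ready N (z ∷ y) s →
      size (s [ Yᵢ ]≔ y) ≤ N × ∃[ s′ ] Runs (readChallenge z) (s [ Yᵢ ]≔ y) s′ × Ready N y s′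
    ready-step z y _ (zero , j , b , o , refl , h) =
      smaller {zero} {j} {b} {o} {y} {zero} {j} {b} {o} {z ∷ y} (n≤1+n _) h ,
      _ , readChallenge-full z , j , 0 , [] , _ , refl ,
      smaller {j} {0} {[]} {judge (g ʳ++ []) a b o} {y} {zero} {j} {b} {o} {z ∷ y}
        (≤-trans (+-monoʳ-≤ (length y) (≤-trans (≤-reflexive (+-identityʳ j)) (m≤m+n j (length b)))) (n≤1+n _)) h
    ready-step z y _ (suc k , j , b , o , refl , h) =
      smaller {suc k} {j} {b} {o} {y} {suc k} {j} {b} {o} {z ∷ y} (n≤1+n _) h ,
      _ , readChallenge-bit z {k} , k , suc j , z ∷ b , o , refl ,
      smaller {k} {suc j} {z ∷ b} {o} {y} {suc k} {j} {b} {o} {z ∷ y} (≤-reflexive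
        (solve 4 (λ y k j b → y :+ (k :+ (con 1 :+ j :+ (con 1 :+ b))) := con 1 :+ y :+ (con 1 :+ k :+ (j :+ b)))
               refl (length y) k j (length b))) h
      where open +-*-Solver using (solve; _:+_; _:=_; con)

    readChallenges-time : ∀ {y k j b o N} → size (ready {w} {x} {g} {a} {ws} k j b o y) ≤ N →
      Within (loopBound readChallenge) N (loop Yᵢ readChallenge) (ready {w} {x} {g} {a} {ws} k j b o y)
    readChallenges-time {y} {k} {j} {b} {o} {N} size≤N =
      loop-time {i = Yᵢ} {readChallenge} {N} (Ready N) readChallenge-wellFormed readChallenge-tame ready-step {ready k j b o y} size≤N
        (k , j , b , o , refl , size≤N)

  verifierBound : Poly
  verifierBound = timeBound setup ⊕ loopBound readChallenge ⟨ con (factor setup) ⊗ X ⊕ con (offset setup) ⟩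

  verifier-time : ∀ f x {w y ws N} → let s = st [] w x y f [] [] [] [] [] [] [] [] [] [] [] ws in
    size s ≤ N → Within verifierBound N verifier s
  verifier-time f x size≤N =
    sequel-bound {p = setup} {loop Yᵢ readChallenge} (loopBound readChallenge) (setup-runs f x) (proj₁ verifier-wellFormed) setup-tame size≤N
      readChallenges-time

-- Dominating sets

module _ {A : Set} where

  Σ[_] : List A → (A → ℕ) → ℕ
  Σ[ xs ] f = sumₗ (map f xs)

  Σ-mono : ∀ xs {f g} → (∀ x → f x ≤ g x) → Σ[ xs ] f ≤ Σ[ xs ] g
  Σ-mono []       f≤g = z≤n
  Σ-mono (x ∷ xs) f≤g = +-mono-≤ (f≤g x) (Σ-mono xs f≤g)

  Σ-+ : ∀ xs f g → Σ[ xs ] (λ x → f x + g x) ≡ Σ[ xs ] f + Σ[ xs ] g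
  Σ-+ []       f g = refl
  Σ-+ (x ∷ xs) f g = trans (cong (f x + g x +_) (Σ-+ xs f g))
    (solve 4 (λ a b c d → a :+ b :+ (c :+ d) := a :+ c :+ (b :+ d)) refl (f x) (g x) (Σ[ xs ] f) (Σ[ xs ] g))
    where open +-*-Solver using (solve; _:+_; _:=_)

  Σ-0 : ∀ xs → Σ[ xs ] (λ _ → 0) ≡ 0
  Σ-0 []       = refl
  Σ-0 (x ∷ xs) = Σ-0 xs

  Σ-1 : ∀ xs → Σ[ xs ] (λ _ → 1) ≡ length xs
  Σ-1 []       = refl
  Σ-1 (x ∷ xs) = cong suc (Σ-1 xs)

  Σ-swap : ∀ xs ys (f : A → A → ℕ) →
           Σ[ xs ] (λ x → Σ[ ys ] (f x)) ≡ Σ[ ys ] (λ y → Σ[ xs ] (λ x → f x y))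
  Σ-swap []       ys f = sym (Σ-0 ys)
  Σ-swap (x ∷ xs) ys f = trans (cong (Σ[ ys ] (f x) +_) (Σ-swap xs ys f))
    (sym (Σ-+ ys (f x) (λ y → Σ[ xs ] (λ x → f x y))))

  Σ-pigeonhole : ∀ x xs f g → Σ[ x ∷ xs ] f ≤ Σ[ x ∷ xs ] g → ∃[ y ] f y ≤ g y
  Σ-pigeonhole x xs f g le with f x ≤? g x
  Σ-pigeonhole x xs       f g le | yes fx≤gx = x , fx≤gx
  Σ-pigeonhole x []       f g le | no  fx≰gx =
    contradiction (subst₂ _≤_ (+-identityʳ (f x)) (+-identityʳ (g x)) le) fx≰gx
  Σ-pigeonhole x (y ∷ xs) f g le | no  fx≰gx =
    Σ-pigeonhole y xs f g (+-cancelˡ-≤ (g x) _ _ (≤-trans (+-monoˡ-≤ _ (≰⇒≥ fx≰gx)) le))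

  indicator : Bool → ℕ
  indicator b = if b then 1 else 0

  ∈-filterᵇ : ∀ (p : A → Bool) {x xs} → p x ≡ true → x ∈ₗ xs → x ∈ₗ filterᵇ p xs
  ∈-filterᵇ p {xs = y ∷ xs} px (here refl) rewrite px = here refl
  ∈-filterᵇ p {xs = y ∷ xs} px (there x∈) with p y
  ... | true  = there (∈-filterᵇ p px x∈)
  ... | false = ∈-filterᵇ p px x∈

  length-filterᵇ-not : ∀ (p : A → Bool) xs → length (filterᵇ (λ x → not (p x)) xs) + Σ[ xs ] (λ x → indicator (p x)) ≡ length xs
  length-filterᵇ-not p []       = refl
  length-filterᵇ-not p (x ∷ xs) with p x
  ... | true  = trans (+-suc _ _) (cong suc (length-filterᵇ-not p xs))
  ... | false = cong suc (length-filterᵇ-not p xs)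

  module _ (_⊳_ : A → A → Bool) (total : ∀ x y → (x ⊳ y) ∨ (y ⊳ x) ≡ true) where

    score : List A → A → ℕ
    score xs y = Σ[ xs ] (λ x → indicator (y ⊳ x))

    -- Double counting: by totality every pair contributes at least 1 in one order or the other, and
    -- exchanging the sums shows that both orders have the same total. So the doubled scores are at
    -- least `length xs` on average.
    scores : ∀ xs → Σ[ xs ] (λ _ → length xs) ≤ Σ[ xs ] (λ y → score xs y + score xs y)
    scores xs = begin
      Σ[ xs ] (λ _ → length xs)
        ≤⟨ Σ-mono xs (λ y → ≤-trans (≤-reflexive (sym (Σ-1 xs))) (Σ-mono xs (λ x → pair y x (total y x)))) ⟩
      Σ[ xs ] (λ y → Σ[ xs ] (λ x → indicator (y ⊳ x) + indicator (x ⊳ y)))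
        ≤⟨ Σ-mono xs (λ y → ≤-reflexive (Σ-+ xs _ _)) ⟩
      Σ[ xs ] (λ y → score xs y + Σ[ xs ] (λ x → indicator (x ⊳ y)))
        ≡⟨ Σ-+ xs _ _ ⟩
      Σ[ xs ] (score xs) + Σ[ xs ] (λ y → Σ[ xs ] (λ x → indicator (x ⊳ y)))
        ≡⟨ cong (Σ[ xs ] (score xs) +_) (Σ-swap xs xs (λ y x → indicator (x ⊳ y))) ⟩
      Σ[ xs ] (score xs) + Σ[ xs ] (score xs)
        ≡⟨ Σ-+ xs (score xs) (score xs) ⟨
      Σ[ xs ] (λ y → score xs y + score xs y) ∎
      where
      open ≤-Reasoning
      pair : ∀ y x → (y ⊳ x) ∨ (x ⊳ y) ≡ true → 1 ≤ indicator (y ⊳ x) + indicator (x ⊳ y)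
      pair y x eq with y ⊳ x | x ⊳ y
      ... | true  | _    = s≤s z≤n
      ... | false | true = ≤-refl

    -- Some vertex beats at least half of xs; the rest is dominated recursively.
    dominating-set : ∀ k xs → length xs < 2 ^ k →
      ∃[ ys ] length ys ≤ k × (∀ {x} → x ∈ₗ xs → ∃[ y ] y ∈ₗ ys × y ⊳ x ≡ true)
    dominating-set k []             _ = [] , z≤n , λ ()
    dominating-set zero (x ∷ xs)    (s≤s ())
    dominating-set (suc k) xs@(x₀ ∷ xs₀) len<
      with Σ-pigeonhole x₀ xs₀ (λ _ → length xs) (λ y → score xs y + score xs y) (scores xs)
    ... | y , half =
      let rest = filterᵇ (λ x → not (y ⊳ x)) xs
          len-rest = length-filterᵇ-not (y ⊳_) xs
          ys , len-ys , dom = dominating-set k rest (halve (length rest) (score xs y) len-rest half len<)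
      in y ∷ ys , s≤s len-ys , dominated ys dom
      where
      halve : ∀ r s → r + s ≡ length xs → length xs ≤ s + s → length xs < 2 ^ suc k → r < 2 ^ k
      halve r s eq le lt = *-cancelˡ-< 2 r (2 ^ k) (begin-strict
        r + (r + 0)  ≡⟨ cong (r +_) (+-identityʳ r) ⟩
        r + r        ≤⟨ +-monoʳ-≤ r (+-cancelʳ-≤ s r s (≤-trans (≤-reflexive eq) le)) ⟩
        r + s        ≡⟨ eq ⟩
        length xs    <⟨ lt ⟩
        2 ^ suc k    ∎)
        where open ≤-Reasoning
      dominated : ∀ ys → (∀ {x} → x ∈ₗ filterᵇ (λ x → not (y ⊳ x)) xs → ∃[ z ] z ∈ₗ ys × z ⊳ x ≡ true) →
                  ∀ {x} → x ∈ₗ xs → ∃[ z ] z ∈ₗ (y ∷ ys) × z ⊳ x ≡ true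
      dominated ys dom {x} x∈ with y ⊳ x in eq
      ... | true  = y , here refl , eq
      ... | false with dom (∈-filterᵇ (λ x → not (y ⊳ x)) (cong not eq) x∈)
      ... | z , z∈ , z⊳x = z , there z∈ , z⊳x

vertices : ∀ n → List (Vec Bool n)
vertices zero    = [] ∷ []
vertices (suc n) = map (false ∷_) (vertices n) ++ₗ map (true ∷_) (vertices n)

∈-vertices : ∀ {n} (v : Vec Bool n) → v ∈ₗ vertices n
∈-vertices []          = here refl
∈-vertices (false ∷ v) = ∈-++⁺ˡ (∈-map⁺ (false ∷_) (∈-vertices v))
∈-vertices (true ∷ v)  = ∈-++⁺ʳ _ (∈-map⁺ (true ∷_) (∈-vertices v))

length-vertices : ∀ n → length (vertices n) ≡ 2 ^ n
length-vertices zero    = refl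
length-vertices (suc n) = trans (length-++ (map (false ∷_) (vertices n)))
  (cong₂ _+_ (trans (length-map _ (vertices n)) (length-vertices n))
             (trans (length-map _ (vertices n)) (trans (length-vertices n) (sym (+-identityʳ _)))))

-- Refuting circuits without a source

_≟ᵥ_ : ∀ {n} (v z : Vec Bool n) → Dec (v ≡ z)
_≟ᵥ_ = ≡-dec Bool._≟_

module _ {n : ℕ} (C : Circuit (n + n)) where

  beats : Vec Bool n → Vec Bool n → Bool
  beats v z = eval C (v ++ z) ∧ not (eval C (z ++ v))

  Refutes : Vec Bool n → Vec Bool n → Set
  Refutes z v = z ≢ v × beats v z ≡ false

  -- An exhaustive search through the finitely many vertices turns the mere absence of a source into
  -- an explicit refutation.
  refuter : ¬ HasSource n C → ∀ v → ∃[ z ] Refutes z v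
  refuter ¬source v with any? (λ z → ¬? (z ≟ᵥ v) ×-dec (beats v z Bool.≟ false)) (vertices n)
  ... | yes found = let z , _ , r = find found in z , r
  ... | no ¬found = contradiction (v , dominates) ¬source
    where
    dominates : ∀ z → z ≢ v → eval C (v ++ z) ≡ true × eval C (z ++ v) ≡ false
    dominates z z≢v with eval C (v ++ z) in eq₁ | eval C (z ++ v) in eq₂
    ... | true  | false = refl , refl
    ... | true  | true  = contradiction (lose (∈-vertices z) (z≢v , cong₂ (λ a b → a ∧ not b) eq₁ eq₂)) ¬found
    ... | false | _     = contradiction (lose (∈-vertices z) (z≢v , cong (_∧ not (eval C (z ++ v))) eq₁)) ¬found

  _⊵_ : Vec Bool n → Vec Bool n → Bool
  z ⊵ v = does (z ≟ᵥ v) ∨ not (beats v z)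

  -- Two vertices cannot beat each other: the values of the circuit that one direction demands are
  -- the negations of those that the other demands.
  ⊵-total : ∀ z v → (z ⊵ v) ∨ (v ⊵ z) ≡ true
  ⊵-total z v with does (z ≟ᵥ v) | does (v ≟ᵥ z) | eval C (v ++ z) | eval C (z ++ v)
  ... | true  | _     | _     | _     = refl
  ... | false | _     | false | _     = refl
  ... | false | _     | true  | true  = refl
  ... | false | true  | true  | false = refl
  ... | false | false | true  | false = refl

  refuters : ¬ HasSource n C →
    ∃[ zs ] length zs ≤ suc n + suc n × (∀ v → ∃[ z ] z ∈ₗ zs × Refutes z v)
  refuters ¬source
    with dominating-set _⊵_ ⊵-total (suc n) (vertices n)
           -- The strict bound needed for domination forces the exponent n + 1: there are exactly 2
           -- ^ n vertices.
           (subst (_< 2 ^ suc n) (sym (length-vertices n)) (^-monoʳ-< 2 ≤-refl {n} {suc n} ≤-refl))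
  ... | ys , len , dom =
    ys ++ₗ map (proj₁ ∘ refuter ¬source) ys
    , ≤-trans (≤-reflexive (trans (length-++ ys) (cong (length ys +_) (length-map _ ys)))) (+-mono-≤ len len)
    , refuted
    where
    refuted : ∀ v → ∃[ z ] z ∈ₗ (ys ++ₗ map (proj₁ ∘ refuter ¬source) ys) × Refutes z v
    refuted v with dom (∈-vertices v)
    ... | y , y∈ , y⊵v with y ≟ᵥ v
    ... | yes refl = proj₁ (refuter ¬source y) , ∈-++⁺ʳ ys (∈-map⁺ _ y∈) , proj₂ (refuter ¬source y)
    ... | no y≢v with beats v y in eq
    ... | false = y , ∈-++⁺ˡ y∈ , y≢v , eq

-- Judging a pair of vertices

reversed : ∀ {n} → Vec Bool n → Word
reversed v = toList v ʳ++ []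

toWord : ∀ {n} (v z : Vec Bool n) → reversed v ʳ++ (reversed z ʳ++ []) ≡ toList (v ++ z)
toWord v z = trans (ʳ++-ʳ++ (toList v))
  (trans (cong (toList v ++ₗ_) (trans (ʳ++-ʳ++ (toList z)) (++ₗ-identityʳ _))) (sym (toList-++ v z)))

mismatch-refl : ∀ a e → mismatch a a e ≡ e
mismatch-refl []          e = refl
mismatch-refl (false ∷ a) e = mismatch-refl a e
mismatch-refl (true ∷ a)  e = mismatch-refl a e

mismatch-∷ : ∀ a b c e → mismatch a b (c ∷ e) ≢ []
mismatch-∷ []          b           c e ()
mismatch-∷ (x ∷ a)     []          c e = mismatch-∷ a [] c e
mismatch-∷ (false ∷ a) (false ∷ b) c e = mismatch-∷ a b c e
mismatch-∷ (false ∷ a) (true ∷ b)  c e = mismatch-∷ a b true (c ∷ e)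
mismatch-∷ (true ∷ a)  (false ∷ b) c e = mismatch-∷ a b true (c ∷ e)
mismatch-∷ (true ∷ a)  (true ∷ b)  c e = mismatch-∷ a b c e

-- Equal lengths matter, as the comparison ignores the surplus of the longer word. A flag once
-- raised stays raised, so any differing position would show.
mismatch-[] : ∀ a b → length a ≡ length b → mismatch a b [] ≡ [] → a ≡ b
mismatch-[] []          []          _  _  = refl
mismatch-[] (false ∷ a) (false ∷ b) le eq = cong (false ∷_) (mismatch-[] a b (suc-injective le) eq)
mismatch-[] (false ∷ a) (true ∷ b)  le eq = ⊥-elim (mismatch-∷ a b true [] eq)
mismatch-[] (true ∷ a)  (false ∷ b) le eq = ⊥-elim (mismatch-∷ a b true [] eq)
mismatch-[] (true ∷ a)  (true ∷ b)  le eq = cong (true ∷_) (mismatch-[] a b (suc-injective le) eq)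

length-toList : ∀ {n} (v : Vec Bool n) → length (toList v) ≡ n
length-toList []      = refl
length-toList (x ∷ v) = cong suc (length-toList v)

length-reversed : ∀ {n} (v : Vec Bool n) → length (reversed v) ≡ n
length-reversed v = trans (length-ʳ++ (toList v)) (trans (+-identityʳ _) (length-toList v))

toList-injective : ∀ {n} (v z : Vec Bool n) → toList v ≡ toList z → v ≡ z
toList-injective []      []      _    = refl
toList-injective (x ∷ v) (y ∷ z) eq with toList v in eq₁ | toList z in eq₂
toList-injective (x ∷ v) (y ∷ z) refl | w | .w = cong (x ∷_) (toList-injective v z (trans eq₁ (sym eq₂)))

reversed-injective : ∀ {n} (v z : Vec Bool n) → reversed v ≡ reversed z → v ≡ z
reversed-injective v z eq = toList-injective v z
  (trans (sym (reverse-involutive (toList v))) (trans (cong (_ʳ++ []) eq) (reverse-involutive (toList z))))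

valid⇒done : ∀ m → valid m ≡ true → ∃[ a ] m ≡ done a
valid⇒done (done a) _ = a , refl

reject-false : ∀ d e → reject d e false ≡ false
reject-false []      e       = refl
reject-false (_ ∷ d) []      = refl
reject-false (_ ∷ d) (_ ∷ e) = refl

judge-false : ∀ u a b → judge u a b false ≡ false
judge-false u a b with valid (evalWord u (b ʳ++ (a ʳ++ []))) | valid (evalWord u (a ʳ++ (b ʳ++ [])))
... | true  | true  = reject-false _ (mismatch a b [])
... | true  | false = reject-false _ (mismatch a b [])
... | false | _     = reject-false _ (mismatch a b [])

-- A valid first evaluation would exhibit a circuit. An invalid one spoils the verdict directly,
-- without recourse to the flags, so even z = v is an effective challenge.
judge-malformed : ∀ {n} u (v z : Vec Bool n) o → (∀ (C : Circuit (n + n)) → u ≢ encodeGates C) →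
                  judge u (reversed v) (reversed z) o ≡ false
judge-malformed u v z o malformed
  with valid (evalWord u (reversed v ʳ++ (reversed z ʳ++ []))) in eq
     | valid (evalWord u (reversed z ʳ++ (reversed v ʳ++ [])))
... | false | true  = reject-false _ (mismatch (reversed v) (reversed z) [])
... | false | false = reject-false _ (mismatch (reversed v) (reversed z) [])
... | true  | _     with valid⇒done _ eq
... | a , eq′ with evalWord-sound (v ++ z) u (trans (cong (evalWord u) (sym (toWord v z))) eq′)
... | C , u≡ = contradiction u≡ (malformed C)

reject-[] : ∀ d o → reject d [] o ≡ o
reject-[] []      o = refl
reject-[] (_ ∷ _) o = refl

judge-done : ∀ u a b o {α β} →
  evalWord u (a ʳ++ (b ʳ++ [])) ≡ done α → evalWord u (b ʳ++ (a ʳ++ [])) ≡ done β →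
  judge u a b o ≡ reject (unexpected false (done β) (unexpected true (done α) [])) (mismatch a b []) o
judge-done u a b o eq₁ eq₂ rewrite eq₁ | eq₂ = refl

reject-both : ∀ α β e o → α ∧ not β ≡ false → e ≢ [] →
              reject (unexpected false (done β) (unexpected true (done α) [])) e o ≡ false
reject-both α     β     []      o eq e≢[] = contradiction refl e≢[]
reject-both false false (_ ∷ _) o eq e≢[] = refl
reject-both false true  (_ ∷ _) o eq e≢[] = refl
reject-both true  true  (_ ∷ _) o eq e≢[] = refl

module _ {n : ℕ} (C : Circuit (n + n)) where

  evaluated : ∀ (v z : Vec Bool n) → evalWord (encodeGates C) (reversed v ʳ++ (reversed z ʳ++ [])) ≡ done (eval C (v ++ z))
  evaluated v z = trans (cong (evalWord (encodeGates C)) (toWord v z)) (evalWord-encodeGates C (v ++ z))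

  judge-refl : ∀ (v : Vec Bool n) o → judge (encodeGates C) (reversed v) (reversed v) o ≡ o
  judge-refl v o = trans (judge-done (encodeGates C) (reversed v) (reversed v) o (evaluated v v) (evaluated v v))
    (trans (cong (λ e → reject flags e o) (mismatch-refl (reversed v) [])) (reject-[] flags o))
    where flags = unexpected false (done (eval C (v ++ v))) (unexpected true (done (eval C (v ++ v))) [])

  judge-beats : ∀ (v z : Vec Bool n) o → eval C (v ++ z) ≡ true → eval C (z ++ v) ≡ false →
                judge (encodeGates C) (reversed v) (reversed z) o ≡ o
  judge-beats v z o eq₁ eq₂ = judge-done (encodeGates C) (reversed v) (reversed z) o
    (trans (evaluated v z) (cong done eq₁)) (trans (evaluated z v) (cong done eq₂))

  judge-refuted : ∀ v z o → Refutes {n} C z v → judge (encodeGates C) (reversed v) (reversed z) o ≡ false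
  judge-refuted v z o (z≢v , eq) = trans (judge-done (encodeGates C) (reversed v) (reversed z) o (evaluated v z) (evaluated z v))
    (reject-both (eval C (v ++ z)) (eval C (z ++ v)) _ o eq λ same →
      z≢v (sym (reversed-injective v z
        (mismatch-[] _ _ (trans (length-reversed v) (sym (length-reversed z))) same))))

-- Judging a challenge

-- A lost verdict is never regained, so a single refuting block decides whatever follows it.
judgeBlocks-false : ∀ u a k j b y → judgeBlocks u a k j b false y ≡ false
judgeBlocks-false u a k       j b []      = refl
judgeBlocks-false u a zero    j b (_ ∷ y) =
  trans (cong (λ o → judgeBlocks u a j 0 [] o y) (judge-false u a b)) (judgeBlocks-false u a j 0 [] y)
judgeBlocks-false u a (suc k) j b (c ∷ y) = judgeBlocks-false u a k (suc j) (c ∷ b) y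

judgeBlocks-word : ∀ u a w j b o c y →
  judgeBlocks u a (length w) j b o (w ++ₗ c ∷ y) ≡
  judgeBlocks u a (length w + j) 0 [] (judge u a (w ʳ++ b) o) y
judgeBlocks-word u a []      j b o c y = refl
judgeBlocks-word u a (x ∷ w) j b o c y =
  trans (judgeBlocks-word u a w (suc j) (x ∷ b) o c y)
        (cong (λ k → judgeBlocks u a k 0 [] (judge u a (w ʳ++ (x ∷ b)) o) y) (+-suc (length w) j))

judgeBlocks-vertex : ∀ {n} u a (z : Vec Bool n) o y →
  judgeBlocks u a n 0 [] o (toList z ++ₗ true ∷ y) ≡ judgeBlocks u a n 0 [] (judge u a (reversed z) o) y
judgeBlocks-vertex u a z o y =
  subst (λ k → judgeBlocks u a k 0 [] o (toList z ++ₗ true ∷ y) ≡ judgeBlocks u a k 0 [] (judge u a (reversed z) o) y)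
    (length-toList z)
    (trans (judgeBlocks-word u a (toList z) 0 [] o true y)
           (cong (λ k → judgeBlocks u a k 0 [] (judge u a (reversed z) o) y) (+-identityʳ (length (toList z)))))

challenge : ∀ {n} → List (Vec Bool n) → Word
challenge []       = []
challenge (z ∷ zs) = toList z ++ₗ true ∷ challenge zs

length-challenge : ∀ {n} (zs : List (Vec Bool n)) → length (challenge zs) ≡ length zs * suc n
length-challenge []       = refl
length-challenge {n} (z ∷ zs) = trans (length-++ (toList z))
  (trans (cong₂ (λ a b → a + suc b) (length-toList z) (length-challenge zs)) (+-suc n _))

judgeBlocks-challenge : ∀ {n} u a {z : Vec Bool n} {zs} o → z ∈ₗ zs →
  (∀ o → judge u a (reversed z) o ≡ false) → judgeBlocks u a n 0 [] o (challenge zs) ≡ false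
judgeBlocks-challenge {n} u a {z} {.z ∷ zs} o (here refl) bad =
  trans (judgeBlocks-vertex u a z o (challenge zs))
  (trans (cong (λ o → judgeBlocks u a n 0 [] o (challenge zs)) (bad o))
         (judgeBlocks-false u a n 0 [] (challenge zs)))
judgeBlocks-challenge u a {zs = z′ ∷ zs} o (there z∈) bad =
  trans (judgeBlocks-vertex u a z′ o (challenge zs)) (judgeBlocks-challenge u a _ z∈ bad)

fromWord : ∀ {n} (w : Word) → length w ≡ n → ∃[ z ] toList {n = n} z ≡ w
fromWord []      refl = [] , refl
fromWord (b ∷ w) refl = let z , eq = fromWord w refl in b ∷ z , cong (b ∷_) eq

-- Nothing is assumed about y: the invariant `k + length b ≡ n` makes every complete block a genuine
-- vertex, to which the hypothesis applies, and an incomplete one is never judged.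
judgeBlocks-true : ∀ {n} u a → (∀ (z : Vec Bool n) → judge u a (reversed z) true ≡ true) →
  ∀ y k b → k + length b ≡ n → judgeBlocks u a k (length b) b true y ≡ true
judgeBlocks-true u a good []      k       b eq = refl
judgeBlocks-true u a good (c ∷ y) (suc k) b eq =
  judgeBlocks-true u a good y k (c ∷ b) (trans (+-suc k _) eq)
judgeBlocks-true u a good (c ∷ y) zero    b eq
  with fromWord (b ʳ++ []) (trans (length-ʳ++ b {[]}) (trans (+-identityʳ _) eq))
... | z , eq′ = trans
  (cong (λ o → judgeBlocks u a (length b) 0 [] o y)
        (trans (cong (λ b → judge u a b true) (sym (trans (cong (_ʳ++ []) eq′) (reverse-involutive b)))) (good z)))
  (judgeBlocks-true u a good y (length b) [] (trans (+-identityʳ _) eq))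

pad-vertex : ∀ n x a → ∃[ v ] pad n x a ≡ toList {n = n} v ʳ++ a
pad-vertex zero    x       a = [] , refl
pad-vertex (suc n) []      a = let v , eq = pad-vertex n [] (false ∷ a) in false ∷ v , eq
pad-vertex (suc n) (b ∷ x) a = let v , eq = pad-vertex n x (b ∷ a) in b ∷ v , eq

pad-toList : ∀ {n} (v : Vec Bool n) a → pad n (toList v) a ≡ toList v ʳ++ a
pad-toList []      a = refl
pad-toList (b ∷ v) a = pad-toList v (b ∷ a)

header-unary : ∀ m n w → header m (unary n ++ₗ w) ≡ n + m
header-unary m zero    w = refl
header-unary m (suc n) w = trans (header-unary (suc m) n w) (+-suc n m)

header-≤ : ∀ m w → header m w ≤ m + length w
header-≤ m []          = m≤m+n m 0
header-≤ m (true ∷ w)  = ≤-trans (header-≤ (suc m) w) (≤-reflexive (sym (+-suc m _)))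
header-≤ m (false ∷ w) = m≤m+n m _

body-unary : ∀ n w → body (unary n ++ₗ w) ≡ w
body-unary zero    w = refl
body-unary (suc n) w = body-unary n w

terminated-unary : ∀ n w → terminated (unary n ++ₗ w) ≡ true
terminated-unary zero    w = refl
terminated-unary (suc n) w = terminated-unary n w

terminated⇒unary : ∀ w → terminated w ≡ true → w ≡ unary (header 0 w) ++ₗ body w
terminated⇒unary w t = go w t 0
  where
  go : ∀ w → terminated w ≡ true → ∀ m → replicate m true ++ₗ w ≡ unary (header m w) ++ₗ body w
  go (false ∷ w) t m = sym (++ₗ-assoc (replicate m true) _ w)
  go (true ∷ w)  t m = trans (shift m) (go w t (suc m))
    where
    shift : ∀ m → replicate m true ++ₗ true ∷ w ≡ true ∷ replicate m true ++ₗ w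
    shift zero    = refl
    shift (suc m) = cong (true ∷_) (shift m)

-- Completeness and soundness of the verdict, and the inclusion

verdict-source : ∀ n (C : Circuit (n + n)) → (source : HasSource n C) →
                 ∀ y → verdict (encode n C) (toList (proj₁ source)) y ≡ true
verdict-source n C (v , dominates) y
  rewrite header-unary 0 n (encodeGates C) | body-unary n (encodeGates C)
        | terminated-unary n (encodeGates C) | +-identityʳ n | pad-toList v [] =
  judgeBlocks-true (encodeGates C) (reversed v) accept y n [] (+-identityʳ n)
  where
  accept : ∀ z → judge (encodeGates C) (reversed v) (reversed z) true ≡ true
  accept z with z ≟ᵥ v
  ... | yes refl = judge-refl {n} C v true
  ... | no z≢v   = judge-beats {n} C v z true (proj₁ (dominates z z≢v)) (proj₂ (dominates z z≢v))

-- The bound is for 2(n + 1) vertices in blocks of n + 1 bits each, with n, the value of the header,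
-- at most `length f`.
Refuting : Word → Set
Refuting f = ∃[ y ] length y ≤ (suc (length f) + suc (length f)) * suc (length f)
                  × (∀ x → verdict f x y ≡ false)

module _ (f : Word) where

  refuting-challenge : (zs : List (Vec Bool (header 0 f))) → length zs ≤ suc (header 0 f) + suc (header 0 f) →
    (∀ v → ∃[ z ] z ∈ₗ zs × (∀ o → judge (body f) (reversed v) (reversed z) o ≡ false)) →
    Refuting f
  refuting-challenge zs len bad = challenge zs , short , rejected
    where
    short : length (challenge zs) ≤ (suc (length f) + suc (length f)) * suc (length f)
    short = ≤-trans (≤-reflexive (length-challenge zs))
      (*-mono-≤ (≤-trans len (+-mono-≤ (s≤s (header-≤ 0 f)) (s≤s (header-≤ 0 f)))) (s≤s (header-≤ 0 f)))
    rejected : ∀ x → verdict f x (challenge zs) ≡ false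
    rejected x with pad-vertex (header 0 f) x []
    ... | v , eq rewrite eq with bad v
    ... | z , z∈ , bad-z = judgeBlocks-challenge (body f) (reversed v) (terminated f) z∈ bad-z

-- A no-instance has no complete header, or a body that is no circuit of the right arity, or a
-- circuit without a source. The first two cases are detected by computation, so the third remains
-- with an actual circuit at hand.
verdict-no-source : ∀ f → ¬ WeakTournamentSource f → Refuting f
verdict-no-source f ¬source with terminated f Bool.≟ true
... | no ¬t = [] , z≤n , λ x → ¬-not ¬t
... | yes t = wellTerminated (valid (evalWord (body f) (toList (zeros ++ zeros)))) refl
  where
  -- An arbitrary choice: one evaluation on any input shows whether the body is a circuit.
  zeros : Vec Bool (header 0 f)
  zeros = Vec.replicate _ false

  wellTerminated : ∀ b → valid (evalWord (body f) (toList (zeros ++ zeros))) ≡ b → Refuting f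
  wellTerminated false eq = refuting-challenge f (zeros ∷ []) (s≤s z≤n) λ v →
    zeros , here refl , λ o → judge-malformed (body f) v zeros o malformed
    where
    malformed : ∀ (C : Circuit (header 0 f + header 0 f)) → body f ≢ encodeGates C
    malformed C u≡ with () ← trans (sym eq)
      (cong valid (trans (cong (λ u → evalWord u (toList (zeros ++ zeros))) u≡)
                         (evalWord-encodeGates C (zeros ++ zeros))))
  wellTerminated true eq =
    let _ , done≡ = valid⇒done _ eq
        C , u≡ = evalWord-sound (zeros ++ zeros) (body f) done≡
    in encodes C u≡
    where
    encodes : (C : Circuit (header 0 f + header 0 f)) → body f ≡ encodeGates C → Refuting f
    encodes C u≡ =
      let f≡ = trans (terminated⇒unary f t) (cong (unary (header 0 f) ++ₗ_) u≡)
          zs , len , refuted = refuters {header 0 f} C (λ source → ¬source (header 0 f , C , f≡ , source))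
      in refuting-challenge f zs len λ v →
           let z , z∈ , r = refuted v
           in z , z∈ , λ o → trans (cong (λ u → judge u (reversed v) (reversed z) o) u≡)
                                   (judge-refuted {header 0 f} C v z o r)

theorem3p3 : PTW ⊆ S₂P
theorem3p3 {L} (f , (M , p , computes) , reduces) =
  P , certificateBound , decides verdict verifierBound verifier-runs verifier-time ,
  λ w → accepts w , rejects w
  where
  open Verifier (TM.#work M)
  -- The verifier uses 16 named stacks, 5 of which are the first tapes of the composed machine; 11
  -- remain, G to E.
  open Compose M 11 verifier verifier-wellFormed
  open Computing f p (λ w → computes (w ∷ []))

  P : Word → Word → Word → Bool
  P w x y = verdict (f w) x y

  -- This is the bound in `Refuting` with `sizeBound` in place of the length of the reduced word; it
  -- also exceeds n, the length of a source.
  certificateBound : Poly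
  certificateBound = (con 1 ⊕ sizeBound ⊕ (con 1 ⊕ sizeBound)) ⊗ (con 1 ⊕ sizeBound)

  accepts : ∀ w → L w → ∃[ x ] length x ≤ ⟦ certificateBound ⟧ (length w)
                             × (∀ y → length y ≤ ⟦ certificateBound ⟧ (length w) → P w x y ≡ true)
  accepts w w∈L with Equivalence.to (reduces w) w∈L
  ... | n , C , f≡ , source = toList (proj₁ source) , short , λ y _ →
    trans (cong (λ u → verdict u (toList (proj₁ source)) y) f≡) (verdict-source n C source y)
    where
    short : length (toList (proj₁ source)) ≤ ⟦ certificateBound ⟧ (length w)
    short = begin
      length (toList (proj₁ source)) ≡⟨ length-toList (proj₁ source) ⟩
      n                              ≤⟨ m≤m+n n 0 ⟩
      n + 0                          ≡⟨ header-unary 0 n (encodeGates C) ⟨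
      header 0 (encode n C)          ≡⟨ cong (header 0) f≡ ⟨
      header 0 (f w)                 ≤⟨ ≤-trans (header-≤ 0 (f w)) (length-f w) ⟩
      q                              ≤⟨ ≤-trans (n≤1+n q) (m≤m+n (suc q) (suc q)) ⟩
      suc q + suc q                  ≤⟨ m≤m*n (suc q + suc q) (suc q) ⟩
      (suc q + suc q) * suc q        ∎
      where
      open ≤-Reasoning
      q = ⟦ sizeBound ⟧ (length w)

  rejects : ∀ w → ¬ L w → ∃[ y ] length y ≤ ⟦ certificateBound ⟧ (length w)
                               × (∀ x → length x ≤ ⟦ certificateBound ⟧ (length w) → P w x y ≡ false)
  rejects w w∉L =
    let y , len , rejected = verdict-no-source (f w) (λ source → w∉L (Equivalence.from (reduces w) source))
        q = s≤s (length-f w)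
    in y , ≤-trans len (*-mono-≤ (+-mono-≤ q q) q) , λ x _ → rejected x
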